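{- Assume that procedures $\mathrm{ZeroTest}$ and $\mathrm{Estimate}$ with the properties described in the context are available. Consider a call $\mathrm{ExactSparseRecovery}(\mathrm{Found},\mathrm{Excl},v,s,k)$ for any vertex $v$ of $T_N^{\mathrm{full}}$, any budget $s\le k$, and any $\mathrm{Found}$ and $\mathrm{Excl}$ such that $v$ is isolated by them and $\mathrm{Found}\cap\mathrm{Leaves}(v)=\emptyset$. If $|\mathrm{HeavyLeaves}(v)|\le s$, then $\mathrm{ExactSparseRecovery}$ returns a correct estimate for every leaf in $\mathrm{HeavyLeaves}(v)$. In particular, if $v=\mathrm{root}$, $\mathrm{Excl}=\emptyset$, $\mathrm{Found}=\emptyset$ and $|\mathrm{HeavyLeaves}(\mathrm{root})|\le s$, the procedure correctly recovers the entire tree.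
   Context: Tree exploration problem. $T_N^{\mathrm{full}}$ is a full binary tree with $N$ leaves, all at depth $\log N$ (logs base 2); each leaf has an unknown complex value, and at most $k$ leaves have non-zero value. $\mathrm{Leaves}(v)$ is the set of leaves of $T_N^{\mathrm{full}}$ that are descendants of $v$ (including $v$ if it is a leaf); $\mathrm{HeavyLeaves}(v)$ is the set of those with non-zero value; for a set $S$ of vertices, $\mathrm{Leaves}(S)=\bigcup_{u\in S}\mathrm{Leaves}(u)$. For a set $S$ of vertices, $T(S)$ is the smallest subtree containing $S$ and the root; $w_S(v)$ is the number of ancestors of $v$ having two children in $T(S\cup\{v\})$. $\mathrm{Found}$ is an associative array of already recovered leaves with estimates of their values; an estimate is correct if it equals the leaf's value; $|\mathrm{Found}|$ is the number of leaves with non-zero estimates in it; every leaf with a non-zero estimate in an input array $\mathrm{Found}$ is a leaf of non-zero value; $+$ denotes union of arrays. $\mathrm{Excl}$ is a set of vertices. A vertex $v$ is isolated by $\mathrm{Found}$ and $\mathrm{Excl}$ if $\mathrm{Leaves}(v)\cap\mathrm{Leaves}(\mathrm{Excl})=\emptyset$ and for every leaf $\ell\notin\mathrm{Leaves}(v)$, either the value of $\ell$ is zero, or $\mathrm{Found}(\ell)$ is correct, or $\ell\in\mathrm{Leaves}(\mathrm{Excl})$. Primitives. $\mathrm{ZeroTest}(\mathrm{Found},\mathrm{Excl},v,b)$: if $v$ is isolated by $\mathrm{Found},\mathrm{Excl}$ and $|\mathrm{HeavyLeaves}(v)|\le b$, it returns True if for every $\ell\in\mathrm{Leaves}(v)$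 the value of $\ell$ is zero or $\mathrm{Found}(\ell)$ is correct, and returns False otherwise; if $v$ is not isolated it may return either answer. $\mathrm{Estimate}(\mathrm{Found},\mathrm{Excl},\ell)$ for a leaf $\ell$: returns the value of $\ell$ if $\ell$ is isolated by $\mathrm{Found},\mathrm{Excl}$, and is arbitrary otherwise. (Rounding of budgets is ignored.) $\mathrm{SlowExactSparseRecovery}(\mathrm{Found},\mathrm{Excl},v,b)$: set $F_v=\{v\}$, $\mathrm{Steps}=1$, $\mathrm{Found}_{out}=\emptyset$. Repeat until $F_v=\emptyset$: if $\mathrm{Steps}>6b\log N$, return $\emptyset$; let $z\in F_v$ minimize $w_{F_v}(z)$; remove $z$ from $F_v$; increment $\mathrm{Steps}$; let $\mathrm{Excl}'=\mathrm{Excl}\cup F_v$, $\mathrm{Found}'=\mathrm{Found}+\mathrm{Found}_{out}$; if $z$ is a leaf of $T_N^{\mathrm{full}}$, set $\mathrm{Found}_{out}(z)=\mathrm{Estimate}(\mathrm{Found}',\mathrm{Excl}',z)$; otherwise, if $\mathrm{ZeroTest}(\mathrm{Found}',\mathrm{Excl}',z,b)$ is False, add both children of $z$ to $F_v$. Finally return $\mathrm{Found}_{out}$. $\mathrm{ExactSparseRecovery}(\mathrm{Found},\mathrm{Excl},v,s,k)$, with $\alpha=2^{ -2\sqrt{\log k\cdot\log\log N}}$: if $s\le1/\alpha$, run $\mathrm{SlowExactSparseRecovery}(\mathrm{Found},\mathrm{Excl},v,s)$ and return its output if it has size at most $s$, else return $\emptyset$. Otherwise set $\mathrm{Found}_{out}=\emptyset$,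 $S=\{v\}$, $\mathrm{Steps}=1$, and repeat the following iteration until $S=\emptyset$ or $\mathrm{Steps}>6\log N/\alpha$ or $|\mathrm{Found}_{out}|>s$. Iteration: let $z\in S$ minimize $w_S(z)$; remove $z$ from $S$; increment $\mathrm{Steps}$; let $\mathrm{Excl}'=\mathrm{Excl}\cup S$, $\mathrm{Found}'=\mathrm{Found}+\mathrm{Found}_{out}$. If $\mathrm{ZeroTest}(\mathrm{Found}',\mathrm{Excl}',z,s)$ is True, end the iteration. If $z$ is a leaf of $T_N^{\mathrm{full}}$, set $\mathrm{Found}_{out}(z)=\mathrm{Estimate}(\mathrm{Found}',\mathrm{Excl}',z)$ and end the iteration. Otherwise let $s_{desc}=\min(\alpha s,\,k-|\mathrm{Found}'|)$, and for each child $u$ of $z$, with $u'$ the other child, compute $\mathrm{Found}_u=\mathrm{ExactSparseRecovery}(\mathrm{Found}',\mathrm{Excl}'\cup\{u'\},u,s_{desc},k)$ and then $\mathrm{IsZero}_u=\mathrm{ZeroTest}(\mathrm{Found}'+\mathrm{Found}_u,\mathrm{Excl}'\cup\{u'\},u,s)$; afterwards, for each child $u$, if $\mathrm{IsZero}_u$ is True, add $\mathrm{Found}_u$ to $\mathrm{Found}_{out}$, else add $u$ to $S$. After the loop: if $S=\emptyset$, $\mathrm{Steps}\le6\log N/\alpha$ and $|\mathrm{Found}_{out}|\le s$, return $\mathrm{Found}_{out}$; otherwise return $\emptyset$.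
   Formalization: In ExactSparseRecovery, Excl' is taken as the union of Excl and S, not the intersection: with the intersection a call on an isolated leaf with Excl={sibling} and both leaves non-zero (N=2, k=s=2) loses isolation and may return the empty array. -}

module Defs where

open import Level using (Level; _⊔_) renaming (suc to lsuc)
open import Algebra.Core using (Op₁; Op₂)
open import Algebra.Structures using (IsCommutativeRing)
open import Algebra.Bundles using (CommutativeRing)
import Algebra.Properties.Monoid.Mult as Mult
import Algebra.Construct.NaturalChoice.Min as Min
open import Data.Bool using (Bool; true; false; if_then_else_)
import Data.Bool.Properties as Bool
open import Data.Empty using (⊥)
open import Data.List as List using (List; []; _∷_; [_]; _++_; filter; length)
open import Data.List.Membership.Propositional using (_∈_)
open import Data.List.Relation.Unary.Any as Any using (Any; here; there)
open import Data.Maybe using (Maybe; just; nothing; fromMaybe; _<∣>_)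
import Data.Maybe.Relation.Unary.Any as MaybeAny
import Data.Nat as ℕ
open import Data.Nat using (ℕ; zero; suc)
open import Data.Product using (_×_; _,_)
open import Data.Product.Relation.Binary.Pointwise.NonDependent
  using (Pointwise; ×-decidable)
open import Data.Sum using (_⊎_; inj₁; inj₂)
import Data.Sum as Sum
open import Data.Vec using (Vec; []; _∷_)
import Data.Vec.Properties as Vec
open import Function using (_⇔_)
open import Relation.Binary using (Rel; IsDecTotalOrder; DecTotalOrder; DecidableEquality; Decidable)
open import Relation.Binary.PropositionalEquality using (_≡_; _≢_; refl; cong)
open import Relation.Nullary using (¬_; Dec; yes; no; ¬?; _×-dec_)
open import Relation.Nullary.Decidable using (map′; does)

------------------------------------------------------------------------
-- Real arithmetic

-- The library has no real numbers.  This is an axiomatisation of what is used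
-- about them: a totally ordered field, with decidable order, carrying
-- functions 2^x, log₂ x and √x.  The real numbers with the usual functions
-- are an instance (classically).  As in ordinary practice _⁻¹, log₂ and √ are
-- total, but nothing is assumed about them outside their domains.

record Reals (c ℓ₁ ℓ₂ : Level) : Set (lsuc (c ⊔ ℓ₁ ⊔ ℓ₂)) where
  infix  8 _⁻¹
  infixl 7 _*_
  infixl 6 _+_
  infix  4 _≈_ _≤_
  field
    Carrier           : Set c
    _≈_               : Rel Carrier ℓ₁
    _≤_               : Rel Carrier ℓ₂
    _+_ _*_           : Op₂ Carrier
    -_ _⁻¹            : Op₁ Carrier
    0# 1#             : Carrier
    isCommutativeRing : IsCommutativeRing _≈_ _+_ _*_ -_ 0# 1#
    isDecTotalOrder   : IsDecTotalOrder _≈_ _≤_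
    0≉1               : ¬ 0# ≈ 1#
    ⁻¹-inverseʳ       : ∀ x → ¬ x ≈ 0# → x * x ⁻¹ ≈ 1#
    +-monoʳ-≤         : ∀ z {x y} → x ≤ y → z + x ≤ z + y
    *-nonNeg          : ∀ {x y} → 0# ≤ x → 0# ≤ y → 0# ≤ x * y

  infix 4 _<_
  _<_ : Rel Carrier ℓ₂
  x < y = ¬ (y ≤ x)

  field
    2^_      : Op₁ Carrier
    2^-cong  : ∀ {x y} → x ≈ y → 2^ x ≈ 2^ y
    2^-mono  : ∀ {x y} → x < y → 2^ x < 2^ y
    2^-+     : ∀ x y → 2^ (x + y) ≈ 2^ x * 2^ y
    2^-1     : 2^ 1# ≈ 1# + 1#

    log₂     : Op₁ Carrier
    2^-log₂  : ∀ x → 0# < x → 2^ (log₂ x) ≈ x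

    √_       : Op₁ Carrier
    √-nonNeg : ∀ x → 0# ≤ x → 0# ≤ √ x
    √-square : ∀ x → 0# ≤ x → √ x * √ x ≈ x

  commutativeRing : CommutativeRing c ℓ₁
  commutativeRing = record { isCommutativeRing = isCommutativeRing }

  decTotalOrder : DecTotalOrder c ℓ₁ ℓ₂
  decTotalOrder = record { isDecTotalOrder = isDecTotalOrder }

  open IsDecTotalOrder isDecTotalOrder public using (_≟_; _≤?_)
  open CommutativeRing commutativeRing public using (_-_)
  open Min (DecTotalOrder.totalOrder decTotalOrder) public using (_⊓_)

  infixl 7 _/_
  _/_ : Op₂ Carrier
  x / y = x * y ⁻¹

  fromℕ : ℕ → Carrier
  fromℕ n = n · 1#
    where open Mult (CommutativeRing.+-monoid commutativeRing) renaming (_×_ to _·_)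

  ℂ : Set c
  ℂ = Carrier × Carrier

  0ℂ : ℂ
  0ℂ = 0# , 0#

  infix 4 _≈ℂ_ _≟ℂ_
  _≈ℂ_ : Rel ℂ ℓ₁
  _≈ℂ_ = Pointwise _≈_ _≈_

  _≟ℂ_ : Decidable _≈ℂ_
  _≟ℂ_ = ×-decidable _≟_ _≟_

------------------------------------------------------------------------
-- The full binary tree of depth d

-- A leaf is the sequence of turns leading to it from the root.
Leaf : ℕ → Set
Leaf d = Vec Bool d

-- down b v is the vertex v of the b-th subtree below the root (which is a tree
-- of smaller depth); it is not the b-th child of v.
data Vertex : ℕ → Set where
  root : ∀ {d} → Vertex d
  down : ∀ {d} → Bool → Vertex d → Vertex (suc d)

leaf : ∀ {d} → Leaf d → Vertex d
leaf []      = root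
leaf (b ∷ ℓ) = down b (leaf ℓ)

-- A vertex is either a leaf or has two children.
children : ∀ {d} → Vertex d → Leaf d ⊎ (Vertex d × Vertex d)
children {zero}  root       = inj₁ []
children {suc d} root       = inj₂ (down false root , down true root)
children         (down b v) =
  Sum.map (b ∷_) (λ (u₁ , u₂) → down b u₁ , down b u₂) (children v)

infix 4 _≼_ _≼?_ _≟ᵛ_ _∈T_ _∈T?_

-- u ≼ v: v is u or a descendant of u.
data _≼_ : ∀ {d} → Vertex d → Vertex d → Set where
  root≼ : ∀ {d} {v : Vertex d} → root ≼ v
  down  : ∀ {d b} {u v : Vertex d} → u ≼ v → down b u ≼ down b v

_≼?_ : ∀ {d} (u v : Vertex d) → Dec (u ≼ v)
root     ≼? v        = yes root≼
down b u ≼? root     = no λ ()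
down b u ≼? down c v with b Bool.≟ c
... | no b≢c   = no λ { (down _) → b≢c refl }
... | yes refl = map′ down (λ { (down p) → p }) (u ≼? v)

_≟ᵛ_ : ∀ {d} → DecidableEquality (Vertex d)
root     ≟ᵛ root     = yes refl
root     ≟ᵛ down c v = no λ ()
down b u ≟ᵛ root     = no λ ()
down b u ≟ᵛ down c v with b Bool.≟ c
... | no b≢c   = no λ { refl → b≢c refl }
... | yes refl = map′ (cong (down b)) (λ { refl → refl }) (u ≟ᵛ v)

allLeaves : ∀ d → List (Leaf d)
allLeaves zero    = [ [] ]
allLeaves (suc d) =
  List.map (false ∷_) (allLeaves d) ++ List.map (true ∷_) (allLeaves d)

-- Finite sets of vertices are represented by lists; order and repetitions are
-- irrelevant.
VertexSet : ℕ → Set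
VertexSet d = List (Vertex d)

infixl 6 _∖_
_∖_ : ∀ {d} → VertexSet d → Vertex d → VertexSet d
S ∖ z = filter (λ y → ¬? (y ≟ᵛ z)) S

Leaves : ∀ {d} → Vertex d → Leaf d → Set
Leaves v ℓ = v ≼ leaf ℓ

LeavesOf : ∀ {d} → VertexSet d → Leaf d → Set
LeavesOf S ℓ = Any (λ u → Leaves u ℓ) S

-- x ∈T S: x is a vertex of T(S).  The smallest subtree containing S and the
-- root is the least set containing both and closed under taking parents.
data _∈T_ {d} : Vertex d → VertexSet d → Set where
  root∈   : ∀ {S} → root ∈T S
  member  : ∀ {S x} → x ∈ S → x ∈T S
  parent₁ : ∀ {S x u₁ u₂} → children x ≡ inj₂ (u₁ , u₂) → u₁ ∈T S → x ∈T S
  parent₂ : ∀ {S x u₁ u₂} → children x ≡ inj₂ (u₁ , u₂) → u₂ ∈T S → x ∈T S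

private
  ≼-refl : ∀ {d} (v : Vertex d) → v ≼ v
  ≼-refl root       = root≼
  ≼-refl (down b v) = down (≼-refl v)

  ≼-parent : ∀ {d} (x : Vertex d) {u₁ u₂} → children x ≡ inj₂ (u₁ , u₂) →
             ∀ {y} → u₁ ≼ y ⊎ u₂ ≼ y → x ≼ y
  ≼-parent root       eq p = root≼
  ≼-parent (down b x) eq p with children x in eq′
  ≼-parent (down b x) refl (inj₁ (down p)) | inj₂ _ = down (≼-parent x eq′ (inj₁ p))
  ≼-parent (down b x) refl (inj₂ (down p)) | inj₂ _ = down (≼-parent x eq′ (inj₂ p))

  ParentClosed : ∀ {d} → (Vertex d → Set) → Set
  ParentClosed P = ∀ {x u₁ u₂} → children x ≡ inj₂ (u₁ , u₂) → P u₁ ⊎ P u₂ → P x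

  below : ∀ {d} b {P : Vertex (suc d) → Set} →
          ParentClosed P → ParentClosed (λ v → P (down b v))
  below b closed eq p =
    closed (cong (Sum.map (b ∷_) (λ (u₁ , u₂) → down b u₁ , down b u₂)) eq) p

  lift : ∀ {d} {P : Vertex d → Set} → ParentClosed P → ∀ {x y} → x ≼ y → P y → P x
  lift closed {y = root}         root≼ p = p
  lift closed {y = down false y} root≼ p =
    closed refl (inj₁ (lift (below false closed) {root} root≼ p))
  lift closed {y = down true y}  root≼ p =
    closed refl (inj₂ (lift (below true closed) {root} root≼ p))
  lift closed (down {b = b} x≼y) p = lift (below b closed) x≼y p

  ∈T⇒ : ∀ {d} {S : VertexSet d} {x} → x ∈T S → Any (x ≼_) (root ∷ S)
  ∈T⇒ root∈          = here root≼
  ∈T⇒ (member x∈S)   = there (Any.map (λ { refl → ≼-refl _ }) x∈S)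
  ∈T⇒ (parent₁ eq p) = Any.map (λ q → ≼-parent _ eq (inj₁ q)) (∈T⇒ p)
  ∈T⇒ (parent₂ eq p) = Any.map (λ q → ≼-parent _ eq (inj₂ q)) (∈T⇒ p)

  ∈T-closed : ∀ {d} {S : VertexSet d} → ParentClosed (_∈T S)
  ∈T-closed eq (inj₁ p) = parent₁ eq p
  ∈T-closed eq (inj₂ p) = parent₂ eq p

  ∈T⇐ : ∀ {d} {S : VertexSet d} {x} → Any (x ≼_) (root ∷ S) → x ∈T S
  ∈T⇐ (here x≼root) = lift ∈T-closed x≼root root∈
  ∈T⇐ (there p)     = go p (λ q → q)
    where
    go : ∀ {S S′ x} → Any (x ≼_) S′ → (∀ {y} → y ∈ S′ → y ∈ S) → x ∈T S
    go (here x≼y) S′⊆S = lift ∈T-closed x≼y (member (S′⊆S (here refl)))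
    go (there q)  S′⊆S = go q (λ r → S′⊆S (there r))

_∈T?_ : ∀ {d} (x : Vertex d) (S : VertexSet d) → Dec (x ∈T S)
x ∈T? S = map′ ∈T⇐ ∈T⇒ (Any.any? (x ≼?_) (root ∷ S))

-- Proper ancestors.
ancestors : ∀ {d} → Vertex d → VertexSet d
ancestors root       = []
ancestors (down b v) = root ∷ List.map (down b) (ancestors v)

TwoChildrenIn : ∀ {d} → VertexSet d → Vertex d → Set
TwoChildrenIn S x =
  Sum.[ (λ _ → ⊥) , (λ (u₁ , u₂) → u₁ ∈T S × u₂ ∈T S) ] (children x)

twoChildrenIn? : ∀ {d} (S : VertexSet d) x → Dec (TwoChildrenIn S x)
twoChildrenIn? S x with children x
... | inj₁ _         = no λ ()
... | inj₂ (u₁ , u₂) = (u₁ ∈T? S) ×-dec (u₂ ∈T? S)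

w : ∀ {d} → VertexSet d → Vertex d → ℕ
w S v = length (filter (twoChildrenIn? (v ∷ S)) (ancestors v))

-- A rule for choosing a vertex of least weight; ties are broken arbitrarily.
record Selector (d : ℕ) : Set where
  field
    pick     : VertexSet d → Vertex d
    pick-∈   : ∀ S → S ≢ [] → pick S ∈ S
    pick-min : ∀ S → S ≢ [] → ∀ {y} → y ∈ S → w S (pick S) ℕ.≤ w S y

------------------------------------------------------------------------
-- Arrays, and the procedures

module SparseRecovery {c ℓ₁ ℓ₂} (ℛ : Reals c ℓ₁ ℓ₂) (d k : ℕ) where

  open Reals ℛ

  -- nothing: no estimate has been recorded for that leaf.
  Array : Set c
  Array = Leaf d → Maybe ℂ

  ∅ : Array
  ∅ _ = nothing

  -- Should both arrays have an entry, the second (more recent) one is kept.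
  infixl 6 _⊕_
  _⊕_ : Array → Array → Array
  (F ⊕ G) ℓ = G ℓ <∣> F ℓ

  infixl 7 _[_≔_]
  _[_≔_] : Array → Leaf d → ℂ → Array
  (F [ ℓ ≔ x ]) ℓ′ = if does (Vec.≡-dec Bool._≟_ ℓ ℓ′) then just x else F ℓ′

  NonZeroAt : Array → Leaf d → Set (c ⊔ ℓ₁)
  NonZeroAt F ℓ = MaybeAny.Any (λ x → ¬ x ≈ℂ 0ℂ) (F ℓ)

  size : Array → ℕ
  size F = length (filter (λ ℓ → MaybeAny.dec (λ x → ¬? (x ≟ℂ 0ℂ)) (F ℓ)) (allLeaves d))

  N : ℕ
  N = 2 ℕ.^ d

  logN : Carrier
  logN = log₂ (fromℕ N)

  α : Carrier
  α = 2^ (- (fromℕ 2 * √ (log₂ (fromℕ k) * log₂ logN)))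

  module Values (value : Leaf d → ℂ) where

    Heavy : Leaf d → Set ℓ₁
    Heavy ℓ = ¬ value ℓ ≈ℂ 0ℂ

    HeavyLeaves : Vertex d → Leaf d → Set ℓ₁
    HeavyLeaves v ℓ = Leaves v ℓ × Heavy ℓ

    ∣HeavyLeaves∣ : Vertex d → ℕ
    ∣HeavyLeaves∣ v =
      length (filter (λ ℓ → (v ≼? leaf ℓ) ×-dec ¬? (value ℓ ≟ℂ 0ℂ)) (allLeaves d))

    Correct : Array → Leaf d → Set (c ⊔ ℓ₁)
    Correct F ℓ = MaybeAny.Any (_≈ℂ value ℓ) (F ℓ)

    record Isolated (Found : Array) (Excl : VertexSet d) (v : Vertex d) : Set (c ⊔ ℓ₁) where
      field
        disjoint : ∀ ℓ → Leaves v ℓ → ¬ LeavesOf Excl ℓ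
        outside  : ∀ ℓ → ¬ Leaves v ℓ →
                   value ℓ ≈ℂ 0ℂ ⊎ Correct Found ℓ ⊎ LeavesOf Excl ℓ

    -- The standing assumption on input arrays.
    NonZeroOnlyAtHeavy : Array → Set (c ⊔ ℓ₁)
    NonZeroOnlyAtHeavy F = ∀ ℓ → NonZeroAt F ℓ → Heavy ℓ

    record Primitives : Set (c ⊔ ℓ₁ ⊔ ℓ₂) where
      field
        ZeroTest : Array → VertexSet d → Vertex d → Carrier → Bool
        Estimate : Array → VertexSet d → Leaf d → ℂ

        zeroTest-spec : ∀ Found Excl v b →
          Isolated Found Excl v → fromℕ (∣HeavyLeaves∣ v) ≤ b →
          ZeroTest Found Excl v b ≡ true ⇔
          (∀ ℓ → Leaves v ℓ → value ℓ ≈ℂ 0ℂ ⊎ Correct Found ℓ)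

        estimate-spec : ∀ Found Excl ℓ →
          Isolated Found Excl (leaf ℓ) → Estimate Found Excl ℓ ≈ℂ value ℓ

    -- Both procedures are given by their big-step semantics: the last index of
    -- each relation is the array returned.  A loop is indexed by its state
    -- (the set of pending vertices, Steps and Found_out).  As pick, ZeroTest and
    -- Estimate are functions, an execution is determined by its input.
    module Procedures (selector : Selector d) (primitives : Primitives) where

      open Selector selector
      open Primitives primitives

      data SlowLoop (Found : Array) (Excl : VertexSet d) (b : Carrier) :
                    VertexSet d → ℕ → Array → Array → Set (c ⊔ ℓ₂) where

        finish : ∀ {t out} → SlowLoop Found Excl b [] t out out

        giveUp : ∀ {F t out} → F ≢ [] →
          fromℕ 6 * b * logN < fromℕ t →
          SlowLoop Found Excl b F t out ∅

        atLeaf : ∀ {F t out ret} → F ≢ [] →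
          fromℕ t ≤ fromℕ 6 * b * logN →
          let z      = pick F
              F∖z    = F ∖ z
              Excl′  = Excl ++ F∖z
              Found′ = Found ⊕ out
          in ∀ {ℓ} → children z ≡ inj₁ ℓ →
          SlowLoop Found Excl b F∖z (suc t) (out [ ℓ ≔ Estimate Found′ Excl′ ℓ ]) ret →
          SlowLoop Found Excl b F t out ret

        discard : ∀ {F t out ret} → F ≢ [] →
          fromℕ t ≤ fromℕ 6 * b * logN →
          let z      = pick F
              F∖z    = F ∖ z
              Excl′  = Excl ++ F∖z
              Found′ = Found ⊕ out
          in ∀ {u₁ u₂} → children z ≡ inj₂ (u₁ , u₂) →
          ZeroTest Found′ Excl′ z b ≡ true →
          SlowLoop Found Excl b F∖z (suc t) out ret →
          SlowLoop Found Excl b F t out ret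

        expand : ∀ {F t out ret} → F ≢ [] →
          fromℕ t ≤ fromℕ 6 * b * logN →
          let z      = pick F
              F∖z    = F ∖ z
              Excl′  = Excl ++ F∖z
              Found′ = Found ⊕ out
          in ∀ {u₁ u₂} → children z ≡ inj₂ (u₁ , u₂) →
          ZeroTest Found′ Excl′ z b ≡ false →
          SlowLoop Found Excl b (u₁ ∷ u₂ ∷ F∖z) (suc t) out ret →
          SlowLoop Found Excl b F t out ret

      SlowExactSparseRecovery :
        Array → VertexSet d → Vertex d → Carrier → Array → Set (c ⊔ ℓ₂)
      SlowExactSparseRecovery Found Excl v b ret =
        SlowLoop Found Excl b [ v ] 1 ∅ ret

      mutual

        data ExactSparseRecovery (Found : Array) (Excl : VertexSet d) (v : Vertex d) (s : Carrier) :
                                 Array → Set (c ⊔ ℓ₂) where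

          slow : ∀ {ret} → s ≤ 1# / α →
            SlowExactSparseRecovery Found Excl v s ret →
            fromℕ (size ret) ≤ s →
            ExactSparseRecovery Found Excl v s ret

          slowTooLarge : ∀ {ret} → s ≤ 1# / α →
            SlowExactSparseRecovery Found Excl v s ret →
            s < fromℕ (size ret) →
            ExactSparseRecovery Found Excl v s ∅

          fast : ∀ {ret} → 1# / α < s →
            Loop Found Excl s [ v ] 1 ∅ ret →
            ExactSparseRecovery Found Excl v s ret

        data Loop (Found : Array) (Excl : VertexSet d) (s : Carrier) :
                  VertexSet d → ℕ → Array → Array → Set (c ⊔ ℓ₂) where

          finish : ∀ {t out} →
            fromℕ t ≤ fromℕ 6 * logN / α → fromℕ (size out) ≤ s →
            Loop Found Excl s [] t out out

          giveUp : ∀ {S t out} →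
            fromℕ 6 * logN / α < fromℕ t ⊎ s < fromℕ (size out) →
            Loop Found Excl s S t out ∅

          iterate : ∀ {S t out S′ out′ ret} → S ≢ [] →
            fromℕ t ≤ fromℕ 6 * logN / α → fromℕ (size out) ≤ s →
            let z = pick S in
            Iteration (Found ⊕ out) (Excl ++ (S ∖ z)) s z (S ∖ z) out S′ out′ →
            Loop Found Excl s S′ (suc t) out′ ret →
            Loop Found Excl s S t out ret

        -- Found and Excl stand for Found′ and Excl′ here, S for the pending set
        -- from which z has been removed; the last two indices are the new
        -- pending set and Found_out.
        data Iteration (Found : Array) (Excl : VertexSet d) (s : Carrier)
                       (z : Vertex d) (S : VertexSet d) (out : Array) :
                       VertexSet d → Array → Set (c ⊔ ℓ₂) where

          discard :
            ZeroTest Found Excl z s ≡ true →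
            Iteration Found Excl s z S out S out

          atLeaf : ∀ {ℓ} →
            ZeroTest Found Excl z s ≡ false →
            children z ≡ inj₁ ℓ →
            Iteration Found Excl s z S out S (out [ ℓ ≔ Estimate Found Excl ℓ ])

          expand : ∀ {u₁ u₂ Found₁ Found₂} →
            ZeroTest Found Excl z s ≡ false →
            children z ≡ inj₂ (u₁ , u₂) →
            let s-desc  = (α * s) ⊓ (fromℕ k - fromℕ (size Found))
                isZero₁ = ZeroTest (Found ⊕ Found₁) (u₂ ∷ Excl) u₁ s
                isZero₂ = ZeroTest (Found ⊕ Found₂) (u₁ ∷ Excl) u₂ s
            in
            ExactSparseRecovery Found (u₂ ∷ Excl) u₁ s-desc Found₁ →
            ExactSparseRecovery Found (u₁ ∷ Excl) u₂ s-desc Found₂ →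
            Iteration Found Excl s z S out
              ((if isZero₁ then [] else [ u₁ ]) ++ (if isZero₂ then [] else [ u₂ ]) ++ S)
              (out ⊕ (if isZero₁ then Found₁ else ∅) ⊕ (if isZero₂ then Found₂ else ∅))

    RecoversTree : Array → Set ℓ₁
    RecoversTree F = ∀ ℓ → fromMaybe 0ℂ (F ℓ) ≈ℂ value ℓ

{-# OPTIONS --safe #-}
module Submission where

-- When a call has enough budget, every entry it records is correct: at all
-- times the leaves of v are either below a pending vertex, or zero, or
-- correctly recorded, so each vertex that is picked is isolated and ZeroTest
-- and Estimate can be trusted.  A recursive call may lack budget, but its output
-- is kept only if ZeroTest, run with the larger budget s, accepts it; an
-- accepted output has at least as many entries as there are heavy leaves, and
-- at most s-desc, so the call had enough budget after all.
--
-- It remains to see that the limit on the steps is never hit.  In the fast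
-- procedure a rejected child has more than α s heavy leaves.  As the heavy
-- leaves of v number at most s and each lies below at most d rejected vertices,
-- at most d / α of those are ever pending.  In the slow procedure an expanded
-- vertex has a heavy leaf below it, which bounds the number of vertices
-- visited by 1 + 2 d |HeavyLeaves(v)|.

open import Defs
open import Algebra.Bundles using (CommutativeRing)
import Algebra.Construct.NaturalChoice.Min as Min
import Algebra.Properties.Ring as RingProperties
import Algebra.Properties.Semiring.Mult as Mult
import Algebra.Solver.Ring.NaturalCoefficients.Default as SemiringSolver
open import Data.Bool using (Bool; true; false; if_then_else_)
import Data.Bool.Properties as Bool
open import Data.List using (List; []; _∷_; [_]; _++_; filter; length; map)
open import Data.List.Membership.Propositional using (_∈_; find; lose)
open import Data.List.Membership.Propositional.Properties
  using (∈-++⁺ˡ; ∈-++⁺ʳ; ∈-++⁻; ∈-map⁺; ∈-filter⁺; ∈-filter⁻)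
open import Data.List.Properties using (filter-some; filter-none; ++-assoc; map-++)
import Data.List.Relation.Unary.All as All
open import Data.List.Relation.Unary.Any using (here; there)
import Data.List.Relation.Unary.Any.Properties as Any
open import Data.Maybe using (Maybe; just; nothing; _<∣>_)
open import Data.Maybe.Properties using (<∣>-assoc)
import Data.Maybe.Relation.Unary.Any as MaybeAny
import Data.Nat as ℕ
open import Data.Nat using (ℕ; zero; suc; s≤s; z≤n) renaming (_≤_ to _≤ⁿ_)
open import Data.Nat.ListAction using (sum)
open import Data.Nat.ListAction.Properties using (sum-++)
import Data.Nat.Properties as ℕ
open import Data.Nat.Solver using (module +-*-Solver)
open import Data.Product using (_×_; _,_; ∃; ∃₂; proj₁; proj₂)
open import Data.Sum using (_⊎_; inj₁; inj₂)
import Data.Sum as Sum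
open import Data.Vec using ([]; _∷_)
import Data.Vec.Properties as Vec
open import Function using (_∘_; id; const)
open import Function.Bundles using (module Equivalence)
open import Level using (_⊔_)
open import Relation.Binary.Bundles using (DecTotalOrder)
open import Relation.Binary.PropositionalEquality
  using (_≡_; _≢_; refl; sym; trans; cong; subst)
import Relation.Binary.Reasoning.Preorder as PreorderReasoning
open import Relation.Nullary using (¬_; Dec; yes; no; ¬?; _×-dec_; contradiction)
open import Relation.Nullary.Decidable using (decidable-stable)
open import Relation.Unary using (Pred; Decidable)

-- Counting

module _ {a p q r} {A : Set a} {P : Pred A p} {Q : Pred A q} {R : Pred A r}
         (P? : Decidable P) (Q? : Decidable Q) (R? : Decidable R) where

  -- Serves for the heavy leaves of two siblings, and for the recorded leaves against the heavy
  -- leaves of an unexplored subtree.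
  length-filter-disjoint :
    (∀ {x} → P x → ¬ Q x) → (∀ {x} → P x → R x) → (∀ {x} → Q x → R x) →
    ∀ xs → length (filter P? xs) ℕ.+ length (filter Q? xs) ≤ⁿ length (filter R? xs)
  length-filter-disjoint P∩Q P⊆R Q⊆R [] = z≤n
  length-filter-disjoint P∩Q P⊆R Q⊆R (x ∷ xs)
    with ih ← length-filter-disjoint P∩Q P⊆R Q⊆R xs | P? x | Q? x | R? x
  ... | yes p | yes q | _     = contradiction q (P∩Q p)
  ... | yes p | no _  | yes _ = s≤s ih
  ... | no _  | yes _ | yes _ = ℕ.≤-trans (ℕ.≤-reflexive (ℕ.+-suc _ _)) (s≤s ih)
  ... | no _  | no _  | yes _ = ℕ.m≤n⇒m≤1+n ih
  ... | no _  | no _  | no _  = ih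
  ... | yes p | no _  | no ¬r = contradiction (P⊆R p) ¬r
  ... | no _  | yes q | no ¬r = contradiction (Q⊆R q) ¬r

module _ {a p r} {A : Set a} {P : Pred A p} {R : Pred A r}
         (P? : Decidable P) (R? : Decidable R) where

  length-filter-⊆ : (∀ {x} → P x → R x) →
    ∀ xs → length (filter P? xs) ≤ⁿ length (filter R? xs)
  length-filter-⊆ P⊆R xs = ℕ.≤-trans (ℕ.m≤m+n _ _)
    (length-filter-disjoint P? (λ _ → no id) R? (λ _ ()) P⊆R (λ ()) xs)

∈-allLeaves : ∀ {d} (ℓ : Leaf d) → ℓ ∈ allLeaves d
∈-allLeaves []          = here refl
∈-allLeaves (false ∷ ℓ) = ∈-++⁺ˡ (∈-map⁺ _ (∈-allLeaves ℓ))
∈-allLeaves (true  ∷ ℓ) = ∈-++⁺ʳ _ (∈-map⁺ _ (∈-allLeaves ℓ))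

-- The tree

≼-refl : ∀ {d} (v : Vertex d) → v ≼ v
≼-refl root       = root≼
≼-refl (down b v) = down (≼-refl v)

leaf≼leaf⇒≡ : ∀ {d} {ℓ ℓ′ : Leaf d} → leaf ℓ ≼ leaf ℓ′ → ℓ ≡ ℓ′
leaf≼leaf⇒≡ {ℓ = []}    {[]}     _        = refl
leaf≼leaf⇒≡ {ℓ = b ∷ ℓ} {_ ∷ ℓ′} (down p) = cong (b ∷_) (leaf≼leaf⇒≡ p)

height : ∀ {d} → Vertex d → ℕ
height {d} root       = d
height     (down _ v) = height v

height≤ : ∀ {d} (v : Vertex d) → height v ≤ⁿ d
height≤ root       = ℕ.≤-refl
height≤ (down _ v) = ℕ.m≤n⇒m≤1+n (height≤ v)

-- An inductive form of `children z ≡ inj₂ (u₁ , u₂)`. Facts about siblings then follow by induction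
-- on the path to `z`, without unfolding `Sum.map` each time.
data Children : ∀ {d} → Vertex d → Vertex d → Vertex d → Set where
  atRoot : ∀ {d} → Children (root {suc d}) (down false root) (down true root)
  below  : ∀ {d b} {z u₁ u₂ : Vertex d} →
           Children z u₁ u₂ → Children (down b z) (down b u₁) (down b u₂)

children⇒Children : ∀ {d} (z : Vertex d) {u₁ u₂} →
                    children z ≡ inj₂ (u₁ , u₂) → Children z u₁ u₂
children⇒Children {suc d} root       refl = atRoot
children⇒Children         (down b z) eq   with children z in eq′
children⇒Children         (down b z) refl | inj₂ _ = below (children⇒Children z eq′)

children⇒leaf : ∀ {d} (z : Vertex d) {ℓ} → children z ≡ inj₁ ℓ → z ≡ leaf ℓ
children⇒leaf {zero} root       refl = refl
children⇒leaf        (down b z) eq   with children z in eq′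
children⇒leaf        (down b z) refl | inj₁ _ = cong (down b) (children⇒leaf z eq′)

Disjoint : ∀ {d} → Vertex d → Vertex d → Set
Disjoint u v = ∀ ℓ → Leaves u ℓ → ¬ Leaves v ℓ

Children-heightˡ : ∀ {d} {z u₁ u₂ : Vertex d} → Children z u₁ u₂ → height z ≡ suc (height u₁)
Children-heightˡ atRoot    = refl
Children-heightˡ (below c) = Children-heightˡ c

Children-heightʳ : ∀ {d} {z u₁ u₂ : Vertex d} → Children z u₁ u₂ → height z ≡ suc (height u₂)
Children-heightʳ atRoot    = refl
Children-heightʳ (below c) = Children-heightʳ c

Children-⊆ˡ : ∀ {d} {z u₁ u₂ : Vertex d} → Children z u₁ u₂ → ∀ ℓ → Leaves u₁ ℓ → Leaves z ℓ
Children-⊆ˡ atRoot    ℓ       p        = root≼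
Children-⊆ˡ (below c) (b ∷ ℓ) (down p) = down (Children-⊆ˡ c ℓ p)

Children-⊆ʳ : ∀ {d} {z u₁ u₂ : Vertex d} → Children z u₁ u₂ → ∀ ℓ → Leaves u₂ ℓ → Leaves z ℓ
Children-⊆ʳ atRoot    ℓ       p        = root≼
Children-⊆ʳ (below c) (b ∷ ℓ) (down p) = down (Children-⊆ʳ c ℓ p)

Children-cover : ∀ {d} {z u₁ u₂ : Vertex d} → Children z u₁ u₂ →
                 ∀ ℓ → Leaves z ℓ → Leaves u₁ ℓ ⊎ Leaves u₂ ℓ
Children-cover atRoot    (false ∷ ℓ) p        = inj₁ (down root≼)
Children-cover atRoot    (true  ∷ ℓ) p        = inj₂ (down root≼)
Children-cover (below c) (b ∷ ℓ)     (down p) = Sum.map down down (Children-cover c ℓ p)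

Children-disjoint : ∀ {d} {z u₁ u₂ : Vertex d} → Children z u₁ u₂ → Disjoint u₁ u₂
Children-disjoint atRoot    (false ∷ ℓ) p        ()
Children-disjoint atRoot    (true  ∷ ℓ) ()       q
Children-disjoint (below c) (b ∷ ℓ)     (down p) (down q) = Children-disjoint c ℓ p q

-- Sums over vertex sets

∑ : ∀ {d} → (Vertex d → ℕ) → VertexSet d → ℕ
∑ f S = sum (map f S)

module _ {d} (f : Vertex d → ℕ) where

  ∑-++ : ∀ A B → ∑ f (A ++ B) ≡ ∑ f A ℕ.+ ∑ f B
  ∑-++ A B = trans (cong sum (map-++ f A B)) (sum-++ (map f A) (map f B))

  ∑-∖-≤ : ∀ S z → ∑ f (S ∖ z) ≤ⁿ ∑ f S
  ∑-∖-≤ []      z = z≤n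
  ∑-∖-≤ (y ∷ S) z with y ≟ᵛ z
  ... | yes _ = ℕ.≤-trans (∑-∖-≤ S z) (ℕ.m≤n+m _ (f y))
  ... | no _  = ℕ.+-monoʳ-≤ (f y) (∑-∖-≤ S z)

  -- A list may repeat `z`, and every copy is removed, so only an inequality holds.
  ∑-∖ : ∀ {S z} → z ∈ S → f z ℕ.+ ∑ f (S ∖ z) ≤ⁿ ∑ f S
  ∑-∖ {y ∷ S} {z} z∈S with y ≟ᵛ z
  ∑-∖ {y ∷ S} {z} _           | yes refl = ℕ.+-monoʳ-≤ (f y) (∑-∖-≤ S y)
  ∑-∖ {y ∷ S} {z} (here refl) | no y≢y   = contradiction refl y≢y
  ∑-∖ {y ∷ S} {z} (there z∈S) | no _     = begin
    f z ℕ.+ (f y ℕ.+ ∑ f (S ∖ z))  ≡⟨ solve 3 (λ a b c → a :+ (b :+ c) := b :+ (a :+ c)) refl (f z) (f y) _ ⟩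
    f y ℕ.+ (f z ℕ.+ ∑ f (S ∖ z))  ≤⟨ ℕ.+-monoʳ-≤ (f y) (∑-∖ z∈S) ⟩
    f y ℕ.+ ∑ f S                  ∎
    where open ℕ.≤-Reasoning
          open +-*-Solver

  -- The common potential argument, used for termination with `subtreeSize` and for counting the
  -- steps of the slow procedure with `slowCost`.
  ∑-replace : ∀ {S z} → z ∈ S → ∀ A → ∑ f A ℕ.< f z → ∑ f (A ++ (S ∖ z)) ℕ.< ∑ f S
  ∑-replace {S} {z} z∈S A A<z = begin-strict
    ∑ f (A ++ (S ∖ z))       ≡⟨ ∑-++ A (S ∖ z) ⟩
    ∑ f A ℕ.+ ∑ f (S ∖ z)    <⟨ ℕ.+-monoˡ-< _ A<z ⟩
    f z ℕ.+ ∑ f (S ∖ z)      ≤⟨ ∑-∖ z∈S ⟩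
    ∑ f S                    ∎
    where open ℕ.≤-Reasoning

-- Ordered fields

module RealProperties {c ℓ₁ ℓ₂} (ℛ : Reals c ℓ₁ ℓ₂) where

  open Reals ℛ
  open CommutativeRing commutativeRing
    using ( -‿cong; +-cong; +-congˡ; +-congʳ; *-cong; *-congˡ; *-congʳ; *-comm
          ; +-identityʳ; +-identityˡ; *-identityʳ; *-identityˡ; zeroʳ; zeroˡ; -‿inverseˡ
          ; distribˡ; distribʳ; +-comm; +-assoc; ring; semiring; commutativeSemiring)
  open RingProperties ring using (-‿distribˡ-*; -‿involutive)
  open Mult semiring using (×-homo-+; ×1-homo-*)
  open Min (DecTotalOrder.totalOrder decTotalOrder) public using (⊓-glb)
  open DecTotalOrder decTotalOrder public using (module Eq)
    renaming (refl to ≤-refl; reflexive to ≤-reflexive; trans to ≤-trans; total to ≤-total; antisym to ≤-antisym)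

  module ≤-Reasoning = PreorderReasoning (DecTotalOrder.preorder decTotalOrder)
  module Solver = SemiringSolver commutativeSemiring
  open ≤-Reasoning

  ≰⇒≥ : ∀ {x y} → x < y → x ≤ y
  ≰⇒≥ {x} {y} y≰x with ≤-total x y
  ... | inj₁ x≤y = x≤y
  ... | inj₂ y≤x = contradiction y≤x y≰x

  +-mono-≤ : ∀ {x y u v} → x ≤ y → u ≤ v → x + u ≤ y + v
  +-mono-≤ {x} {y} {u} {v} x≤y u≤v = begin
    x + u  ≲⟨ +-monoʳ-≤ x u≤v ⟩
    x + v  ≈⟨ +-comm x v ⟩
    v + x  ≲⟨ +-monoʳ-≤ v x≤y ⟩
    v + y  ≈⟨ +-comm v y ⟩
    y + v  ∎

  -x+[x+y]≈y : ∀ x y → - x + (x + y) ≈ y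
  -x+[x+y]≈y x y = begin-equality
    - x + (x + y)  ≈⟨ +-assoc _ _ _ ⟨
    - x + x + y    ≈⟨ +-congʳ (-‿inverseˡ x) ⟩
    0# + y         ≈⟨ +-identityˡ y ⟩
    y              ∎

  +-cancelˡ-≤ : ∀ {x y z} → x + y ≤ x + z → y ≤ z
  +-cancelˡ-≤ {x} {y} {z} p = begin
    y              ≈⟨ -x+[x+y]≈y x y ⟨
    - x + (x + y)  ≲⟨ +-monoʳ-≤ (- x) p ⟩
    - x + (x + z)  ≈⟨ -x+[x+y]≈y x z ⟩
    z              ∎

  x+[y-x]≈y : ∀ x y → x + (y - x) ≈ y
  x+[y-x]≈y x y = begin-equality
    x + (y - x)    ≈⟨ +-comm _ _ ⟩
    y - x + x      ≈⟨ +-assoc _ _ _ ⟩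
    y + (- x + x)  ≈⟨ +-congˡ (-‿inverseˡ x) ⟩
    y + 0#         ≈⟨ +-identityʳ y ⟩
    y              ∎

  x+y≤z⇒y≤z-x : ∀ {x y z} → x + y ≤ z → y ≤ z - x
  x+y≤z⇒y≤z-x p = +-cancelˡ-≤ (≤-trans p (≤-reflexive (Eq.sym (x+[y-x]≈y _ _))))

  neg-antimono : ∀ {x} → 0# ≤ x → - x ≤ 0#
  neg-antimono {x} 0≤x = begin
    - x       ≈⟨ +-identityʳ (- x) ⟨
    - x + 0#  ≲⟨ +-monoʳ-≤ (- x) 0≤x ⟩
    - x + x   ≈⟨ -‿inverseˡ x ⟩
    0#        ∎

  neg-nonNeg : ∀ {x} → x ≤ 0# → 0# ≤ - x
  neg-nonNeg {x} x≤0 = begin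
    0#        ≈⟨ -‿inverseˡ x ⟨
    - x + x   ≲⟨ +-monoʳ-≤ (- x) x≤0 ⟩
    - x + 0#  ≈⟨ +-identityʳ (- x) ⟩
    - x       ∎

  +-nonNeg : ∀ {x y} → 0# ≤ x → 0# ≤ y → 0# ≤ x + y
  +-nonNeg 0≤x 0≤y = ≤-trans (≤-reflexive (Eq.sym (+-identityʳ 0#))) (+-mono-≤ 0≤x 0≤y)

  *-monoˡ-≤ : ∀ {x y z} → 0# ≤ z → x ≤ y → z * x ≤ z * y
  *-monoˡ-≤ {x} {y} {z} 0≤z x≤y = begin
    z * x                ≈⟨ +-identityʳ _ ⟨
    z * x + 0#           ≲⟨ +-monoʳ-≤ _ (*-nonNeg 0≤z (x+y≤z⇒y≤z-x (≤-trans (≤-reflexive (+-identityʳ x)) x≤y))) ⟩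
    z * x + z * (y - x)  ≈⟨ distribˡ z x (y - x) ⟨
    z * (x + (y - x))    ≈⟨ *-congˡ (x+[y-x]≈y x y) ⟩
    z * y                ∎

  *-monoʳ-≤ : ∀ {x y z} → 0# ≤ z → x ≤ y → x * z ≤ y * z
  *-monoʳ-≤ 0≤z x≤y =
    ≤-trans (≤-reflexive (*-comm _ _)) (≤-trans (*-monoˡ-≤ 0≤z x≤y) (≤-reflexive (*-comm _ _)))

  0≤1 : 0# ≤ 1#
  0≤1 with ≤-total 0# 1#
  ... | inj₁ p = p
  ... | inj₂ p = begin
    0#            ≲⟨ *-nonNeg (neg-nonNeg p) (neg-nonNeg p) ⟩
    - 1# * - 1#   ≈⟨ -‿distribˡ-* 1# (- 1#) ⟨
    - (1# * - 1#) ≈⟨ -‿cong (*-identityˡ (- 1#)) ⟩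
    - (- 1#)      ≈⟨ -‿involutive 1# ⟩
    1#            ∎

  1≰0 : 0# < 1#
  1≰0 1≤0 = 0≉1 (≤-antisym 0≤1 1≤0)

  fromℕ-+ : ∀ m n → fromℕ (m ℕ.+ n) ≈ fromℕ m + fromℕ n
  fromℕ-+ = ×-homo-+ 1#

  fromℕ-* : ∀ m n → fromℕ (m ℕ.* n) ≈ fromℕ m * fromℕ n
  fromℕ-* = ×1-homo-*

  fromℕ-nonNeg : ∀ n → 0# ≤ fromℕ n
  fromℕ-nonNeg zero    = ≤-refl
  fromℕ-nonNeg (suc n) =
    +-nonNeg 0≤1 (fromℕ-nonNeg n)

  fromℕ-mono : ∀ {m n} → m ≤ⁿ n → fromℕ m ≤ fromℕ n
  fromℕ-mono {n = n} z≤n = fromℕ-nonNeg n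
  fromℕ-mono (s≤s m≤n)   = +-monoʳ-≤ 1# (fromℕ-mono m≤n)

  fromℕ-1 : fromℕ 1 ≈ 1#
  fromℕ-1 = +-identityʳ 1#

  -- Powers of two and logarithms.

  2^-cancel-≤ : ∀ {x y} → 2^ x ≤ 2^ y → x ≤ y
  2^-cancel-≤ {x} {y} p = decidable-stable (x ≤? y) λ x≰y → 2^-mono x≰y p

  2^-mono-≤ : ∀ {x y} → x ≤ y → 2^ x ≤ 2^ y
  2^-mono-≤ {x} {y} x≤y with y ≤? x
  ... | yes y≤x = ≤-reflexive (2^-cong (≤-antisym x≤y y≤x))
  ... | no y≰x  = ≰⇒≥ (2^-mono y≰x)

  double-cancel-≤ : ∀ {x y} → x + x ≤ y + y → x ≤ y
  double-cancel-≤ {x} {y} p with ≤-total x y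
  ... | inj₁ x≤y = x≤y
  ... | inj₂ y≤x = +-cancelˡ-≤ (≤-trans (+-mono-≤ y≤x ≤-refl) p)

  -- Twice `2^ 0#` equals `2^ 1# * 2^ 0#`, that is `2^ 1#`, which is `1# + 1#`; the doubling is then
  -- cancelled using the order.
  2^-0 : 2^ 0# ≈ 1#
  2^-0 = ≤-antisym (double-cancel-≤ (≤-reflexive x+x≈1+1))
                   (double-cancel-≤ (≤-reflexive (Eq.sym x+x≈1+1)))
    where
    x = 2^ 0#
    x+x≈1+1 : x + x ≈ 1# + 1#
    x+x≈1+1 = begin-equality
      x + x              ≈⟨ +-cong (*-identityˡ x) (*-identityˡ x) ⟨
      1# * x + 1# * x    ≈⟨ distribʳ x 1# 1# ⟨
      (1# + 1#) * x      ≈⟨ *-congʳ 2^-1 ⟨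
      2^ 1# * 2^ 0#      ≈⟨ 2^-+ 1# 0# ⟨
      2^ (1# + 0#)       ≈⟨ 2^-cong (+-identityʳ 1#) ⟩
      2^ 1#              ≈⟨ 2^-1 ⟩
      1# + 1#            ∎

  2^-fromℕ : ∀ n → 2^ (fromℕ n) ≈ fromℕ (2 ℕ.^ n)
  2^-fromℕ zero    = Eq.trans 2^-0 (Eq.sym fromℕ-1)
  2^-fromℕ (suc n) = begin-equality
    2^ (1# + fromℕ n)            ≈⟨ 2^-+ 1# (fromℕ n) ⟩
    2^ 1# * 2^ (fromℕ n)         ≈⟨ *-cong (Eq.trans 2^-1 (+-congˡ (Eq.sym fromℕ-1))) (2^-fromℕ n) ⟩
    fromℕ 2 * fromℕ (2 ℕ.^ n)    ≈⟨ fromℕ-* 2 (2 ℕ.^ n) ⟨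
    fromℕ (2 ℕ.^ suc n)          ∎

  1≤fromℕ : ∀ {n} → 1 ≤ⁿ n → 1# ≤ fromℕ n
  1≤fromℕ 1≤n = ≤-trans (≤-reflexive (Eq.sym fromℕ-1)) (fromℕ-mono 1≤n)

  log₂-nonNeg : ∀ {x} → 1# ≤ x → 0# ≤ log₂ x
  log₂-nonNeg {x} 1≤x = 2^-cancel-≤ (begin
    2^ 0#        ≈⟨ 2^-0 ⟩
    1#           ≲⟨ 1≤x ⟩
    x            ≈⟨ 2^-log₂ x (λ x≤0 → 1≰0 (≤-trans 1≤x x≤0)) ⟨
    2^ (log₂ x)  ∎)

  -- The constant `α` and the step limit of the fast procedure.

  module _ {d k : ℕ} (1≤d : 1 ≤ⁿ d) (1≤k : 1 ≤ⁿ k) where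

    open SparseRecovery ℛ d k using (logN; α)

    d≤logN : fromℕ d ≤ logN
    d≤logN = 2^-cancel-≤ (≤-reflexive (Eq.trans (2^-fromℕ d)
      (Eq.sym (2^-log₂ _ (λ p → 1≰0 (≤-trans (1≤fromℕ (ℕ.m^n>0 2 d)) p))))))

    1≤logN : 1# ≤ logN
    1≤logN = ≤-trans (1≤fromℕ 1≤d) d≤logN

    private
      e : Carrier
      e = fromℕ 2 * √ (log₂ (fromℕ k) * log₂ logN)

      -- Here `1 ≤ d` and `1 ≤ k` enter: they make `log₂ logN` and `log₂ (fromℕ k)` non-negative, so
      -- the root is taken inside its domain.
      0≤e : 0# ≤ e
      0≤e = *-nonNeg (fromℕ-nonNeg 2)
        (√-nonNeg _ (*-nonNeg (log₂-nonNeg (1≤fromℕ 1≤k)) (log₂-nonNeg 1≤logN)))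

      α*2^e : α * 2^ e ≈ 1#
      α*2^e = Eq.trans (Eq.sym (2^-+ (- e) e)) (Eq.trans (2^-cong (-‿inverseˡ e)) 2^-0)

      0≤2^e : 0# ≤ 2^ e
      0≤2^e = ≤-trans 0≤1 (≤-trans (≤-reflexive (Eq.sym 2^-0)) (2^-mono-≤ 0≤e))

    α≤1 : α ≤ 1#
    α≤1 = ≤-trans (2^-mono-≤ (neg-antimono 0≤e)) (≤-reflexive 2^-0)

    -- `α` has the non-negative inverse `2^ e`, so `α ≤ 0` would force `1 ≤ 0`.
    α≰0 : 0# < α
    α≰0 α≤0 = 1≰0 (begin
      1#          ≈⟨ α*2^e ⟨
      α * 2^ e    ≲⟨ *-monoʳ-≤ 0≤2^e α≤0 ⟩
      0# * 2^ e   ≈⟨ zeroˡ _ ⟩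
      0#          ∎)

    0≤α : 0# ≤ α
    0≤α = ≰⇒≥ α≰0

    α*α⁻¹ : α * α ⁻¹ ≈ 1#
    α*α⁻¹ = ⁻¹-inverseʳ α λ α≈0 → α≰0 (≤-reflexive α≈0)

    -- The form in which the branch condition of the fast procedure is used: it makes `α * s` a
    -- non-negative unit of charge and bounds `s * logN` below by one.
    1/α<s⇒1≤αs : ∀ {s} → 1# / α < s → 1# ≤ α * s
    1/α<s⇒1≤αs {s} p = begin
      1#               ≈⟨ α*α⁻¹ ⟨
      α * α ⁻¹         ≈⟨ *-congˡ (*-identityˡ _) ⟨
      α * (1# * α ⁻¹)  ≲⟨ *-monoˡ-≤ 0≤α (≰⇒≥ p) ⟩
      α * s            ∎

    -- Multiply by α s: were the limit exceeded, 6 s log N ≤ 2 α s + d s ≤ 3 s log N,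
    -- which is impossible as s log N ≥ 1.
    steps≤limit : ∀ {s t} → 1# / α < s →
                  t * (α * s) ≤ (α * s + α * s) + fromℕ d * s →
                  t ≤ fromℕ 6 * logN / α
    steps≤limit {s} {t} 1/α<s bound = decidable-stable (t ≤? _) λ t≰ → 1≰0 (begin
      1#           ≲⟨ 1≤x ⟩
      x            ≈⟨ +-identityʳ x ⟨
      x + 0#       ≲⟨ +-monoʳ-≤ x (+-nonNeg 0≤x 0≤x) ⟩
      x + (x + x)  ≲⟨ +-cancelˡ-≤ (6x≤3x (≰⇒≥ t≰)) ⟩
      0#           ∎)
      where
      open Solver using (solve; _:=_; _:+_; _:*_; con)
      a = α * s
      x = s * logN
      1≤a : 1# ≤ a
      1≤a = 1/α<s⇒1≤αs 1/α<s
      0≤s : 0# ≤ s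
      0≤s = decidable-stable (0# ≤? s) λ s<0 → 1≰0 (≤-trans 1≤a
        (≤-trans (*-monoˡ-≤ 0≤α (≰⇒≥ s<0)) (≤-reflexive (zeroʳ α))))
      a≤s : a ≤ s
      a≤s = ≤-trans (*-monoʳ-≤ 0≤s α≤1) (≤-reflexive (*-identityˡ s))
      s≤x : s ≤ x
      s≤x = ≤-trans (≤-reflexive (Eq.sym (*-identityʳ s))) (*-monoˡ-≤ 0≤s 1≤logN)
      1≤x : 1# ≤ x
      1≤x = ≤-trans 1≤a (≤-trans a≤s s≤x)
      0≤x : 0# ≤ x
      0≤x = ≤-trans 0≤1 1≤x
      6x≤3x : fromℕ 6 * logN / α ≤ t → (x + x + x) + (x + (x + x)) ≤ (x + x + x) + 0#
      6x≤3x p = begin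
        (x + x + x) + (x + (x + x))
          ≈⟨ solve 1 (λ x → (x :+ x :+ x) :+ (x :+ (x :+ x)) :=
               (con 1 :+ (con 1 :+ (con 1 :+ (con 1 :+ (con 1 :+ (con 1 :+ con 0)))))) :* x) Eq.refl x ⟩
        fromℕ 6 * x                         ≈⟨ *-identityʳ _ ⟨
        fromℕ 6 * x * 1#                    ≈⟨ *-congˡ α*α⁻¹ ⟨
        fromℕ 6 * x * (α * α ⁻¹)
          ≈⟨ solve 5 (λ c s l a i → c :* (s :* l) :* (a :* i) := c :* l :* i :* (a :* s))
               Eq.refl (fromℕ 6) s logN α (α ⁻¹) ⟩
        fromℕ 6 * logN * α ⁻¹ * (α * s)     ≲⟨ *-monoʳ-≤ (≤-trans 0≤1 1≤a) p ⟩
        t * (α * s)                         ≲⟨ bound ⟩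
        (a + a) + fromℕ d * s
          ≲⟨ +-mono-≤ (+-mono-≤ (≤-trans a≤s s≤x) (≤-trans a≤s s≤x)) (*-monoʳ-≤ 0≤s d≤logN) ⟩
        (x + x) + logN * s                  ≈⟨ +-congˡ (*-comm logN s) ⟩
        x + x + x                           ≈⟨ +-identityʳ _ ⟨
        (x + x + x) + 0#                    ∎
module Recovery {c ℓ₁ ℓ₂} (ℛ : Reals c ℓ₁ ℓ₂) (d k : ℕ)
  (value : Leaf d → Reals.ℂ ℛ)
  (selector : Selector d) (primitives : SparseRecovery.Values.Primitives ℛ d k value) where

  open Reals ℛ
  open SparseRecovery ℛ d k
  open Values value
  open RealProperties ℛ
  open CommutativeRing commutativeRing
    using (+-congʳ; +-congˡ; +-cong; +-assoc; *-congʳ; *-identityˡ; +-identityʳ; +-identityˡ; zeroˡ)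
  open Selector selector
  open Primitives primitives
  open Procedures selector primitives

  -- Termination

  -- The number of vertices of a full binary tree of height `n`. A vertex outweighs its two children
  -- together, so the total over the pending set is a termination measure.
  treeSize : ℕ → ℕ
  treeSize zero    = 1
  treeSize (suc n) = suc (treeSize n ℕ.+ treeSize n)

  treeSize>0 : ∀ n → 0 ℕ.< treeSize n
  treeSize>0 zero    = s≤s z≤n
  treeSize>0 (suc n) = s≤s z≤n

  subtreeSize : Vertex d → ℕ
  subtreeSize v = treeSize (height v)

  subtreeSize-children : ∀ {z u₁ u₂ : Vertex d} → Children z u₁ u₂ →
                         subtreeSize u₁ ℕ.+ subtreeSize u₂ ℕ.< subtreeSize z
  subtreeSize-children {z} {u₁} {u₂} ch
    rewrite ℕ.suc-injective (trans (sym (Children-heightʳ ch)) (Children-heightˡ ch)) | Children-heightˡ ch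
    = ℕ.≤-refl

  ∑-subtreeSize-pick : ∀ {F m} (F≢[] : F ≢ []) → ∑ subtreeSize F ≤ⁿ m →
                       ∀ A → ∑ subtreeSize A ℕ.< subtreeSize (pick F) →
                       ∑ subtreeSize (A ++ (F ∖ pick F)) ℕ.< m
  ∑-subtreeSize-pick F≢[] F≤m A A<z = ℕ.<-≤-trans (∑-replace subtreeSize (pick-∈ _ F≢[]) A A<z) F≤m

  -- `m` is fuel above the total subtree size of `F`, which drops whenever a vertex is removed or
  -- replaced by its children.
  slow-terminates : ∀ {Found Excl b} m F t out → ∑ subtreeSize F ℕ.< m →
                    ∃ (SlowLoop Found Excl b F t out)
  slow-terminates m [] t out _ = out , finish
  slow-terminates {Found} {Excl} {b} (suc m) F@(_ ∷ _) t out (s≤s F≤m)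
    with fromℕ t ≤? fromℕ 6 * b * logN
  ... | no t≰  = ∅ , giveUp (λ ()) t≰
  ... | yes t≤ with children (pick F) in eq
  ...   | inj₁ ℓ =
    let ret , r = slow-terminates m _ _ _ (∑-subtreeSize-pick {F} (λ ()) F≤m [] (treeSize>0 (height (pick F))))
    in ret , atLeaf (λ ()) t≤ eq r
  ...   | inj₂ (u₁ , u₂)
    with ZeroTest (Found ⊕ out) (Excl ++ (F ∖ pick F)) (pick F) b in zt
  ...     | true  =
    let ret , r = slow-terminates m _ _ _ (∑-subtreeSize-pick {F} (λ ()) F≤m [] (treeSize>0 (height (pick F))))
    in ret , discard (λ ()) t≤ eq zt r
  ...     | false =
    let ret , r = slow-terminates m _ _ _ (∑-subtreeSize-pick {F} (λ ()) F≤m (u₁ ∷ u₂ ∷ []) smaller)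
    in ret , expand (λ ()) t≤ eq zt r
    where
    smaller : subtreeSize u₁ ℕ.+ (subtreeSize u₂ ℕ.+ 0) ℕ.< subtreeSize (pick F)
    smaller rewrite ℕ.+-identityʳ (subtreeSize u₂) =
      subtreeSize-children (children⇒Children (pick F) eq)

  Runs : Vertex d → Set _
  Runs v = ∀ Found Excl s → ∃ (ExactSparseRecovery Found Excl v s)

  -- Together with `acceptedIf`, a name for the conditionals in `expand`, so that both children are
  -- treated by the same lemmas whatever `ZeroTest` answers.
  pendingIf : Bool → Vertex d → VertexSet d
  pendingIf isZero u = if isZero then [] else [ u ]

  acceptedIf : Bool → Array → Array
  acceptedIf isZero F = if isZero then F else ∅

  ∑-pendingIf : ∀ f isZero u → ∑ f (pendingIf isZero u) ≤ⁿ f u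
  ∑-pendingIf f true  u = z≤n
  ∑-pendingIf f false u = ℕ.≤-reflexive (ℕ.+-identityʳ (f u))

  ∈-pendingIf : ∀ isZero {u y} → y ∈ pendingIf isZero u → y ≡ u
  ∈-pendingIf false (here y≡u) = y≡u

  -- The new pending set is exposed as `A ++ S`, so that only `A` has to be weighed against `z`.
  -- Recursive calls go to children of `z`, whose height is below `n`.
  iteration-terminates :
    ∀ n → (∀ u → height u ℕ.< n → Runs u) →
    ∀ Found Excl s z S out → height z ≤ⁿ n →
    ∃₂ λ A out′ → Iteration Found Excl s z S out (A ++ S) out′ ×
                  ∑ subtreeSize A ℕ.< subtreeSize z × (∀ {u} → u ∈ A → height u ≤ⁿ n)
  iteration-terminates n runs Found Excl s z S out z≤n′ with ZeroTest Found Excl z s in zt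
  ... | true  = [] , out , discard zt , treeSize>0 (height z) , λ ()
  ... | false with children z in eq
  ...   | inj₁ ℓ = [] , _ , atLeaf zt eq , treeSize>0 (height z) , λ ()
  ...   | inj₂ (u₁ , u₂) =
    A₁ ++ A₂ , out′ ,
    -- `expand` yields `A₁ ++ (A₂ ++ S)`; the brackets are moved here.
    subst (λ S′ → Iteration Found Excl s z S out S′ out′) (sym (++-assoc A₁ A₂ S))
      (expand zt eq run₁ run₂) ,
    smaller , λ u∈A → Sum.[ A≤n isZero₁ u₁<n , A≤n isZero₂ u₂<n ] (∈-++⁻ A₁ u∈A)
    where
    ch = children⇒Children z eq
    u₁<n : height u₁ ℕ.< n
    u₁<n = subst (_≤ⁿ n) (Children-heightˡ ch) z≤n′
    u₂<n : height u₂ ℕ.< n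
    u₂<n = subst (_≤ⁿ n) (Children-heightʳ ch) z≤n′
    A≤n : ∀ isZero {u y} → height u ℕ.< n → y ∈ pendingIf isZero u → height y ≤ⁿ n
    A≤n isZero u<n y∈ = subst (λ y → height y ≤ⁿ n) (sym (∈-pendingIf isZero y∈)) (ℕ.<⇒≤ u<n)
    s-desc = (α * s) ⊓ (fromℕ k - fromℕ (size Found))
    Found₁ = proj₁ (runs u₁ u₁<n Found (u₂ ∷ Excl) s-desc)
    Found₂ = proj₁ (runs u₂ u₂<n Found (u₁ ∷ Excl) s-desc)
    run₁ = proj₂ (runs u₁ u₁<n Found (u₂ ∷ Excl) s-desc)
    run₂ = proj₂ (runs u₂ u₂<n Found (u₁ ∷ Excl) s-desc)
    isZero₁ = ZeroTest (Found ⊕ Found₁) (u₂ ∷ Excl) u₁ s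
    isZero₂ = ZeroTest (Found ⊕ Found₂) (u₁ ∷ Excl) u₂ s
    A₁ = pendingIf isZero₁ u₁
    A₂ = pendingIf isZero₂ u₂
    out′ = out ⊕ acceptedIf isZero₁ Found₁ ⊕ acceptedIf isZero₂ Found₂
    smaller : ∑ subtreeSize (A₁ ++ A₂) ℕ.< subtreeSize z
    smaller = ℕ.≤-<-trans
      (ℕ.≤-trans (ℕ.≤-reflexive (∑-++ subtreeSize A₁ A₂))
        (ℕ.+-mono-≤ (∑-pendingIf subtreeSize isZero₁ u₁) (∑-pendingIf subtreeSize isZero₂ u₂)))
      (subtreeSize-children ch)

  -- Two nested inductions: `runs` settles the recursive calls, at heights below `n`, while `m`
  -- bounds the total subtree size and decreases from one iteration to the next.
  loop-terminates :
    ∀ n → (∀ u → height u ℕ.< n → Runs u) →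
    ∀ {Found Excl s} m S t out → (∀ {u} → u ∈ S → height u ≤ⁿ n) → ∑ subtreeSize S ℕ.< m →
    ∃ (Loop Found Excl s S t out)
  loop-terminates n runs {Found} {Excl} {s} m S t out S≤n S<m
    with fromℕ t ≤? fromℕ 6 * logN / α | fromℕ (size out) ≤? s
  ... | no t≰  | _       = ∅ , giveUp (inj₁ t≰)
  ... | yes _  | no out≰ = ∅ , giveUp (inj₂ out≰)
  loop-terminates n runs m [] t out S≤n S<m
      | yes t≤ | yes out≤ = out , finish t≤ out≤
  loop-terminates n runs {Found} {Excl} {s} (suc m) S@(_ ∷ _) t out S≤n (s≤s S≤m)
      | yes t≤ | yes out≤ =
    let z   = pick S
        z∈S = pick-∈ S (λ ())
        A , out′ , it , A<z , A≤n =
          iteration-terminates n runs (Found ⊕ out) (Excl ++ (S ∖ z)) s z (S ∖ z) out (S≤n z∈S)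
        ret , r = loop-terminates n runs m (A ++ (S ∖ z)) (suc t) out′
          (λ u∈ → Sum.[ A≤n , (λ u∈S∖z → S≤n (proj₁ (∈-filter⁻ (λ y → ¬? (y ≟ᵛ z)) u∈S∖z))) ] (∈-++⁻ A u∈))
          (∑-subtreeSize-pick {S} (λ ()) S≤m A A<z)
    in ret , iterate (λ ()) t≤ out≤ it r

  terminates : ∀ n v → height v ℕ.< n → Runs v
  terminates (suc n) v (s≤s v≤n) Found Excl s with s ≤? 1# / α
  ... | no s≰ =
    let ret , r = loop-terminates n (terminates n) _ [ v ] 1 ∅ (λ { (here refl) → v≤n }) ℕ.≤-refl
    in ret , fast s≰ r
  ... | yes s≤ with slow-terminates _ [ v ] 1 ∅ ℕ.≤-refl
  ...   | ret , r with fromℕ (size ret) ≤? s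
  ...     | yes ret≤ = ret , slow s≤ r ret≤
  ...     | no ret≰  = ∅ , slowTooLarge s≤ r ret≰

  -- Correctness of partial results

  ≈ℂ-sym : ∀ {x y} → x ≈ℂ y → y ≈ℂ x
  ≈ℂ-sym (p , q) = Eq.sym p , Eq.sym q

  ≈ℂ-trans : ∀ {x y z} → x ≈ℂ y → y ≈ℂ z → x ≈ℂ z
  ≈ℂ-trans (p , q) (p′ , q′) = Eq.trans p p′ , Eq.trans q q′

  ⊕-nothing : ∀ {x y : Maybe ℂ} → x ≡ nothing → y ≡ nothing → (y <∣> x) ≡ nothing
  ⊕-nothing refl refl = refl

  ⊕-just : ∀ (x y : Maybe ℂ) {a} → (y <∣> x) ≡ just a → y ≡ just a ⊎ x ≡ just a
  ⊕-just x (just _) eq = inj₁ eq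
  ⊕-just x nothing  eq = inj₂ eq

  CorrectAt : Leaf d → Maybe ℂ → Set _
  CorrectAt ℓ = MaybeAny.Any (_≈ℂ value ℓ)

  Correct-⊕ˡ : ∀ ℓ {x y} → y ≡ nothing → CorrectAt ℓ x → CorrectAt ℓ (y <∣> x)
  Correct-⊕ˡ ℓ refl p = p

  Correct-⊕ʳ : ∀ ℓ {x y} → CorrectAt ℓ y → CorrectAt ℓ (y <∣> x)
  Correct-⊕ʳ ℓ (MaybeAny.just p) = MaybeAny.just p

  Correct-⊕⁻ : ∀ ℓ {x} y → x ≡ nothing → CorrectAt ℓ (y <∣> x) → CorrectAt ℓ y
  Correct-⊕⁻ ℓ (just _) refl p = p
  Correct-⊕⁻ ℓ nothing  refl ()

  LeavesOf-∖ : ∀ {S : VertexSet d} {z} ℓ → LeavesOf S ℓ → Leaves z ℓ ⊎ LeavesOf (S ∖ z) ℓ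
  LeavesOf-∖ {S} {z} ℓ ℓ∈S with find ℓ∈S
  ... | y , y∈S , y≼ℓ with y ≟ᵛ z
  ...   | yes refl = inj₁ y≼ℓ
  ...   | no y≢z   = inj₂ (lose (∈-filter⁺ (λ y → ¬? (y ≟ᵛ z)) y∈S y≢z) y≼ℓ)

  ∈-∖⁻ : ∀ {S : VertexSet d} {z y} → y ∈ (S ∖ z) → y ∈ S × y ≢ z
  ∈-∖⁻ {z = z} = ∈-filter⁻ (λ y → ¬? (y ≟ᵛ z))

  LeavesOf-∖⁻ : ∀ {S : VertexSet d} {z} ℓ → LeavesOf (S ∖ z) ℓ → LeavesOf S ℓ
  LeavesOf-∖⁻ ℓ ℓ∈ with y , y∈ , y≼ℓ ← find ℓ∈ = lose (proj₁ (∈-∖⁻ y∈)) y≼ℓ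

  Within : Vertex d → VertexSet d → Set
  Within v S = ∀ ℓ → LeavesOf S ℓ → Leaves v ℓ

  Supported : Vertex d → Array → Set _
  Supported v F = ∀ ℓ → ¬ Leaves v ℓ → F ℓ ≡ nothing

  within-[] : ∀ {v} → Within v []
  within-[] ℓ ()

  within-[_] : ∀ v → Within v [ v ]
  within-[ v ] ℓ (here p) = p

  within-++ : ∀ {v} A {B} → Within v A → Within v B → Within v (A ++ B)
  within-++ A inA inB ℓ ℓ∈ = Sum.[ inA ℓ , inB ℓ ] (Any.++⁻ A ℓ∈)

  within-⊆ : ∀ {u v A} → (∀ ℓ → Leaves u ℓ → Leaves v ℓ) → Within u A → Within v A
  within-⊆ u⊆v inA ℓ ℓ∈A = u⊆v ℓ (inA ℓ ℓ∈A)

  within-∈ : ∀ {v z S} → Within v S → z ∈ S → ∀ ℓ → Leaves z ℓ → Leaves v ℓ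
  within-∈ inS z∈S ℓ p = inS ℓ (lose z∈S p)

  within-replace : ∀ {v z S A} → Within v S → z ∈ S → Within z A → Within v (A ++ (S ∖ z))
  within-replace {A = A} inS z∈S inA = within-++ A
    (within-⊆ (within-∈ inS z∈S) inA) (λ ℓ ℓ∈ → inS ℓ (LeavesOf-∖⁻ ℓ ℓ∈))

  supported-⊕ : ∀ {v} {F G : Array} → Supported v F → Supported v G → Supported v (F ⊕ G)
  supported-⊕ F⊆ G⊆ ℓ ¬p = ⊕-nothing (F⊆ ℓ ¬p) (G⊆ ℓ ¬p)

  supported-⊆ : ∀ {u v} {F : Array} → (∀ ℓ → Leaves u ℓ → Leaves v ℓ) → Supported u F → Supported v F
  supported-⊆ u⊆v F⊆ ℓ ¬p = F⊆ ℓ (¬p ∘ u⊆v ℓ)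

  ≔-≢ : ∀ (F : Array) ℓ ℓ′ {x} → ℓ ≢ ℓ′ → (F [ ℓ ≔ x ]) ℓ′ ≡ F ℓ′
  ≔-≢ F ℓ ℓ′ ℓ≢ℓ′ with Vec.≡-dec Bool._≟_ ℓ ℓ′
  ... | yes ℓ≡ℓ′ = contradiction ℓ≡ℓ′ ℓ≢ℓ′
  ... | no _     = refl

  -- Writes a single update as a union with a one-entry array, which makes recording an estimate an
  -- instance of `replace`.
  ≔-⊕ : ∀ (F : Array) ℓ x ℓ′ → (F ⊕ ∅ [ ℓ ≔ x ]) ℓ′ ≡ (F [ ℓ ≔ x ]) ℓ′
  ≔-⊕ F ℓ x ℓ′ with Vec.≡-dec Bool._≟_ ℓ ℓ′
  ... | yes _ = refl
  ... | no _  = refl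

  supported-≔ : ∀ {v} {F : Array} {ℓ x} → Leaves v ℓ → Supported v F → Supported v (F [ ℓ ≔ x ])
  supported-≔ {F = F} {ℓ} v≼ℓ F⊆ ℓ′ ¬p = trans (≔-≢ F ℓ ℓ′ (λ { refl → ¬p v≼ℓ })) (F⊆ ℓ′ ¬p)

  -- out is a correct result for the part of Leaves v that is not below the
  -- pending set S.
  record Progress (v : Vertex d) (S : VertexSet d) (out : Array) : Set (c ⊔ ℓ₁) where
    field
      within   : Within v S
      disjoint : ∀ {y z} → y ∈ S → z ∈ S → y ≢ z → Disjoint y z
      support  : ∀ ℓ → ¬ Leaves v ℓ ⊎ LeavesOf S ℓ → out ℓ ≡ nothing
      correct  : ∀ ℓ {x} → out ℓ ≡ just x → x ≈ℂ value ℓ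
      covered  : ∀ ℓ → Leaves v ℓ → LeavesOf S ℓ ⊎ value ℓ ≈ℂ 0ℂ ⊎ Correct out ℓ

  open Progress

  pending : ∀ v → Progress v [ v ] ∅
  pending v .within   = within-[ v ]
  pending v .disjoint (here refl) (here refl) v≢v = contradiction refl v≢v
  pending v .support  ℓ _ = refl
  pending v .correct  ℓ ()
  pending v .covered  ℓ p = inj₁ (here p)

  allZero : ∀ {v} → (∀ ℓ → Leaves v ℓ → value ℓ ≈ℂ 0ℂ) → Progress v [] ∅
  allZero zeros .within   = within-[]
  allZero zeros .disjoint ()
  allZero zeros .support  ℓ _ = refl
  allZero zeros .correct  ℓ ()
  allZero zeros .covered  ℓ p = inj₂ (inj₁ (zeros ℓ p))

  estimated : ∀ ℓ {x} → x ≈ℂ value ℓ → Progress (leaf ℓ) [] (∅ [ ℓ ≔ x ])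
  estimated ℓ x≈ .within   = within-[]
  estimated ℓ x≈ .disjoint ()
  estimated ℓ x≈ .support  ℓ′ (inj₁ ¬p) = ≔-≢ ∅ ℓ ℓ′ (λ { refl → ¬p (≼-refl (leaf ℓ)) })
  estimated ℓ x≈ .correct  ℓ′ eq with Vec.≡-dec Bool._≟_ ℓ ℓ′
  estimated ℓ x≈ .correct  ℓ′ refl | yes refl = x≈
  estimated ℓ x≈ .covered  ℓ′ p with leaf≼leaf⇒≡ p
  ... | refl with Vec.≡-dec Bool._≟_ ℓ ℓ
  ...   | yes _  = inj₂ (inj₂ (MaybeAny.just x≈))
  ...   | no ℓ≢ℓ = contradiction refl ℓ≢ℓ

  Progress-resp : ∀ {v S} {F G : Array} → (∀ ℓ → F ℓ ≡ G ℓ) → Progress v S F → Progress v S G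
  Progress-resp F≗G P .within       = within P
  Progress-resp F≗G P .disjoint     = disjoint P
  Progress-resp F≗G P .support ℓ o  = trans (sym (F≗G ℓ)) (support P ℓ o)
  Progress-resp F≗G P .correct ℓ eq = correct P ℓ (trans (F≗G ℓ) eq)
  Progress-resp F≗G P .covered ℓ p  =
    Sum.map₂ (Sum.map₂ (subst (MaybeAny.Any _) (F≗G ℓ))) (covered P ℓ p)

  -- The two arrays live on disjoint sets of leaves, so no entry is overwritten by `⊕`.
  join : ∀ {z u₁ u₂ A₁ A₂} {G₁ G₂ : Array} → Children z u₁ u₂ →
         Progress u₁ A₁ G₁ → Progress u₂ A₂ G₂ → Progress z (A₁ ++ A₂) (G₁ ⊕ G₂)
  join {u₁ = u₁} {u₂} {A₁} {A₂} {G₁} {G₂} ch P₁ P₂ = λ where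
      .within → within-++ A₁ (within-⊆ (Children-⊆ˡ ch) (within P₁)) (within-⊆ (Children-⊆ʳ ch) (within P₂))
      .disjoint y∈ z∈ y≢z ℓ p q → separate (∈-++⁻ A₁ y∈) (∈-++⁻ A₁ z∈) y≢z ℓ p q
      .support ℓ (inj₁ ¬z) → ⊕-nothing (support P₁ ℓ (inj₁ (¬z ∘ Children-⊆ˡ ch ℓ)))
                                         (support P₂ ℓ (inj₁ (¬z ∘ Children-⊆ʳ ch ℓ)))
      .support ℓ (inj₂ ℓ∈) → pendingLeaf ℓ (Any.++⁻ A₁ ℓ∈)
      .correct ℓ eq → Sum.[ correct P₂ ℓ , correct P₁ ℓ ] (⊕-just (G₁ ℓ) (G₂ ℓ) eq)
      .covered ℓ p → cover ℓ (Children-cover ch ℓ p)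
    where
    apart : Disjoint u₁ u₂
    apart = Children-disjoint ch
    cross : ∀ {y z} → y ∈ A₁ → z ∈ A₂ → Disjoint y z
    cross y∈ z∈ ℓ p q = apart ℓ (within-∈ (within P₁) y∈ ℓ p) (within-∈ (within P₂) z∈ ℓ q)
    separate : ∀ {y z} → y ∈ A₁ ⊎ y ∈ A₂ → z ∈ A₁ ⊎ z ∈ A₂ → y ≢ z → Disjoint y z
    separate (inj₁ y∈) (inj₁ z∈) y≢z = disjoint P₁ y∈ z∈ y≢z
    separate (inj₁ y∈) (inj₂ z∈) y≢z = cross y∈ z∈
    separate (inj₂ y∈) (inj₁ z∈) y≢z ℓ p q = cross z∈ y∈ ℓ q p
    separate (inj₂ y∈) (inj₂ z∈) y≢z = disjoint P₂ y∈ z∈ y≢z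
    pendingLeaf : ∀ ℓ → LeavesOf A₁ ℓ ⊎ LeavesOf A₂ ℓ → (G₁ ⊕ G₂) ℓ ≡ nothing
    pendingLeaf ℓ (inj₁ ℓ∈) =
      ⊕-nothing (support P₁ ℓ (inj₂ ℓ∈)) (support P₂ ℓ (inj₁ (apart ℓ (within P₁ ℓ ℓ∈))))
    pendingLeaf ℓ (inj₂ ℓ∈) =
      ⊕-nothing (support P₁ ℓ (inj₁ (λ p → apart ℓ p (within P₂ ℓ ℓ∈)))) (support P₂ ℓ (inj₂ ℓ∈))
    cover : ∀ ℓ → Leaves u₁ ℓ ⊎ Leaves u₂ ℓ →
            LeavesOf (A₁ ++ A₂) ℓ ⊎ value ℓ ≈ℂ 0ℂ ⊎ Correct (G₁ ⊕ G₂) ℓ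
    cover ℓ (inj₁ p) = Sum.map Any.++⁺ˡ
      (Sum.map₂ (Correct-⊕ˡ ℓ (support P₂ ℓ (inj₁ (apart ℓ p))))) (covered P₁ ℓ p)
    cover ℓ (inj₂ p) = Sum.map (Any.++⁺ʳ A₁) (Sum.map₂ (Correct-⊕ʳ ℓ)) (covered P₂ ℓ p)

  -- The step shared by both procedures: a picked vertex gives way to the state reached below it.
  -- `A` is empty for a leaf or a zero subtree and otherwise a set of children, possibly empty. As
  -- `out` has no entry below `z`, nothing is overwritten.
  replace : ∀ {v S z A} {out G : Array} → Progress v S out → z ∈ S → Progress z A G →
            Progress v (A ++ (S ∖ z)) (out ⊕ G)
  replace {v} {S} {z} {A} {out} {G} P z∈S Q = λ where
      .within → within-replace (within P) z∈S (within Q)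
      .disjoint x∈ y∈ x≢y → separate (∈-++⁻ A x∈) (∈-++⁻ A y∈) x≢y
      .support ℓ (inj₁ ¬v) → ⊕-nothing (support P ℓ (inj₁ ¬v))
                               (support Q ℓ (inj₁ (¬v ∘ within-∈ (within P) z∈S ℓ)))
      .support ℓ (inj₂ ℓ∈) → pendingLeaf ℓ (Any.++⁻ A ℓ∈)
      .correct ℓ eq → Sum.[ correct Q ℓ , correct P ℓ ] (⊕-just (out ℓ) (G ℓ) eq)
      .covered ℓ p → cover ℓ (z ≼? leaf ℓ) (covered P ℓ p)
    where
    rest : ∀ {y} → y ∈ (S ∖ z) → Disjoint z y
    rest y∈ with y∈S , y≢z ← ∈-∖⁻ y∈ = disjoint P z∈S y∈S (y≢z ∘ sym)
    cross : ∀ {x y} → x ∈ A → y ∈ (S ∖ z) → Disjoint x y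
    cross x∈ y∈ ℓ p q = rest y∈ ℓ (within-∈ (within Q) x∈ ℓ p) q
    separate : ∀ {x y} → x ∈ A ⊎ x ∈ (S ∖ z) → y ∈ A ⊎ y ∈ (S ∖ z) → x ≢ y → Disjoint x y
    separate (inj₁ x∈) (inj₁ y∈) x≢y = disjoint Q x∈ y∈ x≢y
    separate (inj₁ x∈) (inj₂ y∈) x≢y = cross x∈ y∈
    separate (inj₂ x∈) (inj₁ y∈) x≢y ℓ p q = cross y∈ x∈ ℓ q p
    separate (inj₂ x∈) (inj₂ y∈) x≢y = disjoint P (proj₁ (∈-∖⁻ x∈)) (proj₁ (∈-∖⁻ y∈)) x≢y
    pendingLeaf : ∀ ℓ → LeavesOf A ℓ ⊎ LeavesOf (S ∖ z) ℓ → (out ⊕ G) ℓ ≡ nothing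
    pendingLeaf ℓ (inj₁ ℓ∈) =
      ⊕-nothing (support P ℓ (inj₂ (lose z∈S (within Q ℓ ℓ∈)))) (support Q ℓ (inj₂ ℓ∈))
    pendingLeaf ℓ (inj₂ ℓ∈) with y , y∈ , q ← find ℓ∈ =
      ⊕-nothing (support P ℓ (inj₂ (LeavesOf-∖⁻ ℓ ℓ∈))) (support Q ℓ (inj₁ (λ p → rest y∈ ℓ p q)))
    cover : ∀ ℓ → Dec (Leaves z ℓ) → LeavesOf S ℓ ⊎ value ℓ ≈ℂ 0ℂ ⊎ Correct out ℓ →
            LeavesOf (A ++ (S ∖ z)) ℓ ⊎ value ℓ ≈ℂ 0ℂ ⊎ Correct (out ⊕ G) ℓ
    cover ℓ (yes p) _ = Sum.map Any.++⁺ˡ (Sum.map₂ (Correct-⊕ʳ ℓ)) (covered Q ℓ p)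
    cover ℓ (no ¬p) (inj₁ ℓ∈) =
      inj₁ (Any.++⁺ʳ A (Sum.[ (λ p → contradiction p ¬p) , id ] (LeavesOf-∖ ℓ ℓ∈)))
    cover ℓ (no ¬p) (inj₂ o) = inj₂ (Sum.map₂ (Correct-⊕ˡ ℓ (support Q ℓ (inj₁ ¬p))) o)

  -- Calls on which the primitives can be trusted.

  record Admissible (Found : Array) (Excl : VertexSet d) (v : Vertex d) : Set (c ⊔ ℓ₁) where
    field
      nonZero  : NonZeroOnlyAtHeavy Found
      isolated : Isolated Found Excl v
      fresh    : ∀ ℓ → Leaves v ℓ → Found ℓ ≡ nothing

  open Admissible
  open Isolated renaming (disjoint to avoids)

  NonZeroAt-correct : ∀ {v S out} → Progress v S out → NonZeroOnlyAtHeavy out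
  NonZeroAt-correct {out = out} P ℓ nz with out ℓ in eq
  NonZeroAt-correct P ℓ (MaybeAny.just x≉0) | just x =
    λ ℓ≈0 → x≉0 (≈ℂ-trans (correct P ℓ eq) ℓ≈0)

  -- A leaf of `v` outside `z` is below another pending vertex, zero, or correctly recorded in
  -- `out`. A leaf outside `v` is handled by the isolation of `v`, since `out` records nothing
  -- there.
  admissible-pick : ∀ {Found Excl v S out z} → Admissible Found Excl v → Progress v S out → z ∈ S →
                    Admissible (Found ⊕ out) (Excl ++ (S ∖ z)) z
  admissible-pick {Found} {Excl} {v} {S} {out} {z} adm P z∈S = λ where
      .nonZero ℓ nz → nonZero′ ℓ nz
      .isolated .avoids ℓ p ℓ∈ → Sum.[ avoids (isolated adm) ℓ (z⊆v ℓ p)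
                                     , (λ ℓ∈S∖z → let y , y∈ , q = find ℓ∈S∖z
                                                      y∈S , y≢z = ∈-∖⁻ y∈
                                                  in disjoint P z∈S y∈S (y≢z ∘ sym) ℓ p q) ]
                                     (Any.++⁻ Excl ℓ∈)
      .isolated .outside ℓ ¬p → outside′ ℓ ¬p (v ≼? leaf ℓ)
      .fresh ℓ p → ⊕-nothing (fresh adm ℓ (z⊆v ℓ p)) (support P ℓ (inj₂ (lose z∈S p)))
    where
    z⊆v : ∀ ℓ → Leaves z ℓ → Leaves v ℓ
    z⊆v = within-∈ (within P) z∈S
    nonZero′ : NonZeroOnlyAtHeavy (Found ⊕ out)
    nonZero′ ℓ nz with out ℓ | NonZeroAt-correct P ℓ
    ... | just _  | out-nz = out-nz nz
    ... | nothing | _      = nonZero adm ℓ nz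
    outside′ : ∀ ℓ → ¬ Leaves z ℓ → Dec (Leaves v ℓ) →
               value ℓ ≈ℂ 0ℂ ⊎ Correct (Found ⊕ out) ℓ ⊎ LeavesOf (Excl ++ (S ∖ z)) ℓ
    outside′ ℓ ¬p (no ¬v) =
      Sum.map₂ (Sum.map (Correct-⊕ˡ ℓ (support P ℓ (inj₁ ¬v))) Any.++⁺ˡ) (outside (isolated adm) ℓ ¬v)
    outside′ ℓ ¬p (yes v) with covered P ℓ v
    ... | inj₁ ℓ∈S      = inj₂ (inj₂ (Any.++⁺ʳ Excl (Sum.[ (λ p → contradiction p ¬p) , id ] (LeavesOf-∖ ℓ ℓ∈S))))
    ... | inj₂ (inj₁ z) = inj₁ z
    ... | inj₂ (inj₂ o) = inj₂ (inj₁ (Correct-⊕ʳ ℓ o))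

  -- Excluding the sibling takes care of the leaves of `z` outside `u`. The relation between `u` and
  -- `u′` is given by its consequences rather than by `Children`, so that the lemma serves both
  -- children.
  admissible-child : ∀ {Found Excl z u u′} →
    (∀ ℓ → Leaves u ℓ → Leaves z ℓ) → Disjoint u u′ →
    (∀ ℓ → Leaves z ℓ → Leaves u ℓ ⊎ Leaves u′ ℓ) →
    Admissible Found Excl z → Admissible Found (u′ ∷ Excl) u
  admissible-child {Found} {Excl} {z} {u} {u′} u⊆z apart cover adm = λ where
      .nonZero → nonZero adm
      .isolated .avoids ℓ p (here q)   → apart ℓ p q
      .isolated .avoids ℓ p (there ℓ∈) → avoids (isolated adm) ℓ (u⊆z ℓ p) ℓ∈
      .isolated .outside ℓ ¬p → outside′ ℓ ¬p (z ≼? leaf ℓ)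
      .fresh ℓ p → fresh adm ℓ (u⊆z ℓ p)
    where
    outside′ : ∀ ℓ → ¬ Leaves u ℓ → Dec (Leaves z ℓ) →
               value ℓ ≈ℂ 0ℂ ⊎ Correct Found ℓ ⊎ LeavesOf (u′ ∷ Excl) ℓ
    outside′ ℓ ¬p (yes q) = inj₂ (inj₂ (here (Sum.[ (λ p → contradiction p ¬p) , id ] (cover ℓ q))))
    outside′ ℓ ¬p (no ¬q) = Sum.map₂ (Sum.map₂ there) (outside (isolated adm) ℓ ¬q)

  -- `G` may be wrong, but it has no entries outside `u`, and isolation consults the array only
  -- there.
  isolated-⊕ : ∀ {Found Excl u G} → Isolated Found Excl u → Supported u G → Isolated (Found ⊕ G) Excl u
  isolated-⊕ iso G⊆ .avoids        = avoids iso
  isolated-⊕ iso G⊆ .outside ℓ ¬p  =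
    Sum.map₂ (Sum.map₁ (Correct-⊕ˡ ℓ (G⊆ ℓ ¬p))) (outside iso ℓ ¬p)

  -- Numbers of heavy leaves

  heavy? : ∀ v ℓ → Dec (HeavyLeaves v ℓ)
  heavy? v ℓ = (v ≼? leaf ℓ) ×-dec ¬? (value ℓ ≟ℂ 0ℂ)

  nonZeroAt? : ∀ (F : Array) ℓ → Dec (NonZeroAt F ℓ)
  nonZeroAt? F ℓ = MaybeAny.dec (λ x → ¬? (x ≟ℂ 0ℂ)) (F ℓ)

  ∣HeavyLeaves∣-⊆ : ∀ {u v} → (∀ ℓ → Leaves u ℓ → Leaves v ℓ) → ∣HeavyLeaves∣ u ≤ⁿ ∣HeavyLeaves∣ v
  ∣HeavyLeaves∣-⊆ {u} {v} u⊆v =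
    length-filter-⊆ (heavy? u) (heavy? v) (λ (p , q) → u⊆v _ p , q) (allLeaves d)

  ∣HeavyLeaves∣-children : ∀ {z u₁ u₂} → Children z u₁ u₂ →
                           ∣HeavyLeaves∣ u₁ ℕ.+ ∣HeavyLeaves∣ u₂ ≤ⁿ ∣HeavyLeaves∣ z
  ∣HeavyLeaves∣-children {z} {u₁} {u₂} ch =
    length-filter-disjoint (heavy? u₁) (heavy? u₂) (heavy? z)
      (λ (p , _) (q , _) → Children-disjoint ch _ p q)
      (λ (p , q) → Children-⊆ˡ ch _ p , q) (λ (p , q) → Children-⊆ʳ ch _ p , q) (allLeaves d)

  ∣HeavyLeaves∣≡0⇒zero : ∀ {v} → ∣HeavyLeaves∣ v ≡ 0 → ∀ ℓ → Leaves v ℓ → value ℓ ≈ℂ 0ℂ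
  ∣HeavyLeaves∣≡0⇒zero {v} h≡0 ℓ p = decidable-stable (value ℓ ≟ℂ 0ℂ) λ ℓ≉0 →
    ℕ.n≮0 (subst (0 ℕ.<_) h≡0 (filter-some (heavy? v) (lose (∈-allLeaves ℓ) (p , ℓ≉0))))

  size-∅ : size ∅ ≡ 0
  size-∅ = cong length (filter-none (nonZeroAt? ∅) (All.universal (λ _ ()) (allLeaves d)))

  -- Non-zero entries sit at heavy leaves, none of them below `u`. With at most `k` heavy leaves in
  -- all, the term `k - |Found|` of `s-desc` never falls below the number of heavy leaves of `u`.
  size-+-∣HeavyLeaves∣ : ∀ {F : Array} {u} → NonZeroOnlyAtHeavy F →
    (∀ ℓ → Leaves u ℓ → F ℓ ≡ nothing) → size F ℕ.+ ∣HeavyLeaves∣ u ≤ⁿ ∣HeavyLeaves∣ root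
  size-+-∣HeavyLeaves∣ {F} {u} nz fr =
    length-filter-disjoint (nonZeroAt? F) (heavy? u) (heavy? root)
      (λ {ℓ} nzℓ (p , _) → nothing-zero (fr ℓ p) nzℓ)
      (λ {ℓ} nzℓ → root≼ , nz ℓ nzℓ) (λ (_ , q) → root≼ , q) (allLeaves d)
    where
    nothing-zero : ∀ {x : Maybe ℂ} → x ≡ nothing → ¬ MaybeAny.Any (λ x → ¬ x ≈ℂ 0ℂ) x
    nothing-zero refl ()

  -- Correct entries are non-zero only at heavy leaves, and `out` records nothing outside `v`. A
  -- call within budget therefore never exceeds the cap on its output.
  size≤∣HeavyLeaves∣ : ∀ {v S out} → Progress v S out → size out ≤ⁿ ∣HeavyLeaves∣ v
  size≤∣HeavyLeaves∣ {v} {S} {out} P = length-filter-⊆ (nonZeroAt? out) (heavy? v)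
    (λ {ℓ} nz → inside ℓ nz (v ≼? leaf ℓ) , NonZeroAt-correct P ℓ nz) (allLeaves d)
    where
    inside : ∀ ℓ → NonZeroAt out ℓ → Dec (Leaves v ℓ) → Leaves v ℓ
    inside ℓ nz (yes p) = p
    inside ℓ nz (no ¬p) with out ℓ | support P ℓ (inj₁ ¬p)
    inside ℓ () (no ¬p) | .nothing | refl

  ∣HeavyLeaves∣≤size : ∀ {u} {G : Array} → (∀ ℓ → Leaves u ℓ → value ℓ ≈ℂ 0ℂ ⊎ Correct G ℓ) →
                       ∣HeavyLeaves∣ u ≤ⁿ size G
  ∣HeavyLeaves∣≤size {u} {G} ok = length-filter-⊆ (heavy? u) (nonZeroAt? G)
    (λ {ℓ} (p , ℓ≉0) → Sum.[ (λ ℓ≈0 → contradiction ℓ≈0 ℓ≉0)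
                           , MaybeAny.map (λ x≈ℓ x≈0 → ℓ≉0 (≈ℂ-trans (≈ℂ-sym x≈ℓ) x≈0)) ] (ok ℓ p))
    (allLeaves d)

  -- Correctness of ZeroTest and Estimate on admissible arguments

  -- `Found` has no entry below `z`, so a positive answer can only mean that all these leaves are
  -- zero.
  zeroTest-true : ∀ {Found Excl z b} → Admissible Found Excl z → fromℕ (∣HeavyLeaves∣ z) ≤ b →
                  ZeroTest Found Excl z b ≡ true → Progress z [] ∅
  zeroTest-true {Found} {z = z} adm h≤b zt = allZero λ ℓ p →
    unrecorded ℓ p (Equivalence.to (zeroTest-spec _ _ _ _ (isolated adm) h≤b) zt ℓ p)
    where
    unrecorded : ∀ ℓ → Leaves z ℓ → value ℓ ≈ℂ 0ℂ ⊎ Correct Found ℓ → value ℓ ≈ℂ 0ℂ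
    unrecorded ℓ p (inj₁ ℓ≈0) = ℓ≈0
    unrecorded ℓ p (inj₂ o) with () ← subst (CorrectAt ℓ) (fresh adm ℓ p) o

  -- Without heavy leaves the specification forces the answer `true`. The leaf found here pays for
  -- expanding `z` in the slow procedure.
  zeroTest-false : ∀ {Found Excl z b} → Admissible Found Excl z → fromℕ (∣HeavyLeaves∣ z) ≤ b →
                   ZeroTest Found Excl z b ≡ false → 1 ≤ⁿ ∣HeavyLeaves∣ z
  zeroTest-false {z = z} adm h≤b zt with ∣HeavyLeaves∣ z in eq
  ... | suc _ = s≤s z≤n
  ... | zero  with () ← trans (sym zt) (Equivalence.from
    (zeroTest-spec _ _ _ _ (isolated adm) (subst (λ h → fromℕ h ≤ _) (sym eq) h≤b))
    (λ ℓ p → inj₁ (∣HeavyLeaves∣≡0⇒zero eq ℓ p)))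

  estimate-correct : ∀ {Found Excl z ℓ} → Admissible Found Excl z → children z ≡ inj₁ ℓ →
                     Progress z [] (∅ [ ℓ ≔ Estimate Found Excl ℓ ])
  estimate-correct {z = z} adm eq with refl ← children⇒leaf z eq =
    estimated _ (estimate-spec _ _ _ (isolated adm))

  children⇒Leaves : ∀ (z : Vertex d) {ℓ} → children z ≡ inj₁ ℓ → Leaves z ℓ
  children⇒Leaves z {ℓ} eq = subst (_≼ leaf ℓ) (sym (children⇒leaf z eq)) (≼-refl (leaf ℓ))

  within-children : ∀ {z u₁ u₂} → Children z u₁ u₂ → Within z (u₁ ∷ u₂ ∷ [])
  within-children ch ℓ (here p)         = Children-⊆ˡ ch ℓ p
  within-children ch ℓ (there (here p)) = Children-⊆ʳ ch ℓ p

  weight : Vertex d → ℕ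
  weight v = height v ℕ.* ∣HeavyLeaves∣ v

  module Correctness (1≤d : 1 ≤ⁿ d) (1≤k : 1 ≤ⁿ k) (heavy≤k : ∣HeavyLeaves∣ root ≤ⁿ k) where

    weight≤ : ∀ v → weight v ≤ⁿ d ℕ.* ∣HeavyLeaves∣ v
    weight≤ v = ℕ.*-monoˡ-≤ _ (height≤ v)

    -- The slow procedure

    -- Exploring z pays for one step and for the costs of both children,
    -- because z is only expanded when there is a heavy leaf below it.
    slowCost : Vertex d → ℕ
    slowCost v = suc (2 ℕ.* weight v)

    slowCost-children : ∀ {z u₁ u₂} → Children z u₁ u₂ → 1 ≤ⁿ ∣HeavyLeaves∣ z →
                        ∑ slowCost (u₁ ∷ u₂ ∷ []) ℕ.< slowCost z
    slowCost-children {z} {u₁} {u₂} ch 1≤h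
      rewrite ℕ.suc-injective (trans (sym (Children-heightʳ ch)) (Children-heightˡ ch)) | Children-heightˡ ch
      = s≤s (begin
      suc (2 ℕ.* (n ℕ.* h₁)) ℕ.+ (suc (2 ℕ.* (n ℕ.* h₂)) ℕ.+ 0)
        ≡⟨ solve 3 (λ n h₁ h₂ → (con 1 :+ con 2 :* (n :* h₁)) :+ ((con 1 :+ con 2 :* (n :* h₂)) :+ con 0)
                             := con 2 :+ con 2 :* (n :* (h₁ :+ h₂))) refl n h₁ h₂ ⟩
      2 ℕ.+ 2 ℕ.* (n ℕ.* (h₁ ℕ.+ h₂))
        -- The unit costs of the two children are paid by `2 * h`, the share of the extra level of
        -- `z`, as `h` is at least one.
        ≤⟨ ℕ.+-mono-≤ (ℕ.*-monoʳ-≤ 2 1≤h) (ℕ.*-monoʳ-≤ 2 (ℕ.*-monoʳ-≤ n (∣HeavyLeaves∣-children ch))) ⟩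
      2 ℕ.* h ℕ.+ 2 ℕ.* (n ℕ.* h)
        ≡⟨ solve 2 (λ n h → con 2 :* h :+ con 2 :* (n :* h) := con 2 :* (h :+ n :* h)) refl n h ⟩
      2 ℕ.* (suc n ℕ.* h)  ∎)
      where
      open ℕ.≤-Reasoning
      open +-*-Solver
      n = height u₁
      h = ∣HeavyLeaves∣ z
      h₁ = ∣HeavyLeaves∣ u₁
      h₂ = ∣HeavyLeaves∣ u₂

    slowLimit : ∀ {b h t} → 1 ≤ⁿ h → fromℕ h ≤ b → t ≤ⁿ 1 ℕ.+ 2 ℕ.* (d ℕ.* h) →
                fromℕ t ≤ fromℕ 6 * b * logN
    slowLimit {b} {h} {t} 1≤h h≤b t≤ = begin
      fromℕ t                       ≲⟨ fromℕ-mono t≤′ ⟩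
      fromℕ (6 ℕ.* h ℕ.* d)         ≈⟨ fromℕ-* (6 ℕ.* h) d ⟩
      fromℕ (6 ℕ.* h) * fromℕ d     ≈⟨ *-congʳ (fromℕ-* 6 h) ⟩
      fromℕ 6 * fromℕ h * fromℕ d   ≲⟨ *-monoˡ-≤ (*-nonNeg (fromℕ-nonNeg 6) (fromℕ-nonNeg h)) (d≤logN 1≤d 1≤k) ⟩
      fromℕ 6 * fromℕ h * logN      ≲⟨ *-monoʳ-≤ (≤-trans 0≤1 (1≤logN 1≤d 1≤k)) (*-monoˡ-≤ (fromℕ-nonNeg 6) h≤b) ⟩
      fromℕ 6 * b * logN            ∎
      where
      open ≤-Reasoning
      t≤′ : t ≤ⁿ 6 ℕ.* h ℕ.* d
      -- The leading `1` is at most `d * h`, and the factor `2` is widened to `5`, which makes six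
      -- in all.
      t≤′ = ℕ.≤-trans t≤ (ℕ.≤-trans (ℕ.+-mono-≤ (ℕ.*-mono-≤ 1≤d 1≤h) (ℕ.*-monoˡ-≤ (d ℕ.* h) (ℕ.m≤m+n 2 3)))
        (ℕ.≤-reflexive (solve 2 (λ d h → d :* h :+ con 5 :* (d :* h) := con 6 :* h :* d) refl d h)))
        where open +-*-Solver

    slow-step : ∀ {F z t K} → z ∈ F → ∀ A → ∑ slowCost A ℕ.< slowCost z →
                t ℕ.+ ∑ slowCost F ≤ⁿ K → suc t ℕ.+ ∑ slowCost (A ++ (F ∖ z)) ≤ⁿ K
    slow-step {F} {z} {t} z∈F A A<z bound = ℕ.≤-trans
      (ℕ.≤-trans (ℕ.≤-reflexive (sym (ℕ.+-suc t _))) (ℕ.+-monoʳ-≤ t (∑-replace slowCost z∈F A A<z))) bound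

    -- The steps taken plus the cost of what is pending never exceed the initial bound, in which `2`
    -- stands for the initial `Steps = 1` and the unit cost of `v`.
    slow-correct : ∀ {Found Excl v b F t out ret} → SlowLoop Found Excl b F t out ret →
      Admissible Found Excl v → fromℕ (∣HeavyLeaves∣ v) ≤ b → Progress v F out →
      t ℕ.+ ∑ slowCost F ≤ⁿ 2 ℕ.+ 2 ℕ.* (d ℕ.* ∣HeavyLeaves∣ v) → Progress v [] ret
    slow-correct finish adm h≤b P bound = P
    slow-correct {v = v} (giveUp {F} {t} F≢[] t≰) adm h≤b P bound with ∣HeavyLeaves∣ v in eq
    -- With `b = 0` the limit is zero and the first step already exceeds it; without heavy leaves
    -- the empty output is nevertheless right.
    ... | zero  = allZero (∣HeavyLeaves∣≡0⇒zero eq)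
    -- A pending vertex costs at least one, which leaves `t` strictly below the bound.
    ... | suc h = contradiction (slowLimit {t = t} (s≤s z≤n) h≤b (ℕ.s≤s⁻¹ (begin
      suc t                    ≡⟨ ℕ.+-comm 1 t ⟩
      t ℕ.+ 1                  ≤⟨ ℕ.+-monoʳ-≤ t (s≤s z≤n) ⟩
      t ℕ.+ slowCost (pick F)  ≤⟨ ℕ.+-monoʳ-≤ t (ℕ.≤-trans (ℕ.m≤m+n _ _) (∑-∖ slowCost (pick-∈ F F≢[]))) ⟩
      t ℕ.+ ∑ slowCost F       ≤⟨ bound ⟩
      _                        ∎))) t≰
      where open ℕ.≤-Reasoning
    slow-correct (atLeaf {F} {out = out} F≢[] _ {ℓ} eq r) adm h≤b P bound =
      slow-correct r adm h≤b
        (Progress-resp (≔-⊕ out ℓ _) (replace P z∈F (estimate-correct (admissible-pick adm P z∈F) eq)))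
        (slow-step z∈F [] (s≤s z≤n) bound)
      where z∈F = pick-∈ F F≢[]
    slow-correct (discard {F} F≢[] _ eq zt r) adm h≤b P bound =
      slow-correct r adm h≤b
        (replace P z∈F (zeroTest-true (admissible-pick adm P z∈F)
          (≤-trans (fromℕ-mono (∣HeavyLeaves∣-⊆ (within-∈ (within P) z∈F))) h≤b) zt))
        (slow-step z∈F [] (s≤s z≤n) bound)
      where z∈F = pick-∈ F F≢[]
    slow-correct (expand {F} F≢[] _ {u₁} {u₂} eq zt r) adm h≤b P bound =
      slow-correct r adm h≤b
        (replace P z∈F (join ch (pending _) (pending _)))
        (slow-step z∈F (u₁ ∷ u₂ ∷ []) (slowCost-children ch (zeroTest-false (admissible-pick adm P z∈F)
          (≤-trans (fromℕ-mono (∣HeavyLeaves∣-⊆ (within-∈ (within P) z∈F))) h≤b) zt)) bound)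
      where
      z∈F = pick-∈ F F≢[]
      ch  = children⇒Children (pick F) eq

    -- Properties of the output that hold for all arguments

    slow-supported : ∀ {Found Excl v b F t out ret} → SlowLoop Found Excl b F t out ret →
                     Within v F → Supported v out → Supported v ret
    slow-supported finish F⊆ out⊆ = out⊆
    slow-supported (giveUp _ _) F⊆ out⊆ = λ _ _ → refl
    slow-supported (atLeaf {F} F≢[] _ eq r) F⊆ out⊆ =
      slow-supported r (within-replace F⊆ z∈F within-[])
        (supported-≔ (within-∈ F⊆ z∈F _ (children⇒Leaves (pick F) eq)) out⊆)
      where z∈F = pick-∈ F F≢[]
    slow-supported (discard {F} F≢[] _ eq zt r) F⊆ out⊆ =
      slow-supported r (within-replace F⊆ (pick-∈ F F≢[]) within-[]) out⊆
    slow-supported (expand {F} F≢[] _ eq zt r) F⊆ out⊆ =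
      slow-supported r (within-replace F⊆ (pick-∈ F F≢[])
        (within-children (children⇒Children (pick F) eq))) out⊆

    within-pendingIf : ∀ isZero u → Within u (pendingIf isZero u)
    within-pendingIf true  u = within-[]
    within-pendingIf false u = within-[ u ]

    supported-acceptedIf : ∀ isZero {u F} → Supported u F → Supported u (acceptedIf isZero F)
    supported-acceptedIf true  F⊆ = F⊆
    supported-acceptedIf false F⊆ = λ _ _ → refl

    mutual

      -- Holds even for calls without enough budget. Their output may be wrong, but only below `v`,
      -- so `v` stays isolated when that output is added to `Found` for `ZeroTest`.
      supported : ∀ {Found Excl v s ret} → ExactSparseRecovery Found Excl v s ret → Supported v ret
      supported (slow _ r _)         = slow-supported r within-[ _ ] (λ _ _ → refl)
      supported (slowTooLarge _ _ _) = λ _ _ → refl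
      supported (fast _ r)           = loop-supported r within-[ _ ] (λ _ _ → refl)

      loop-supported : ∀ {Found Excl v s S t out ret} → Loop Found Excl s S t out ret →
                       Within v S → Supported v out → Supported v ret
      loop-supported (finish _ _) S⊆ out⊆ = out⊆
      loop-supported (giveUp _) S⊆ out⊆ = λ _ _ → refl
      loop-supported (iterate {S} S≢[] _ _ (discard _) r) S⊆ out⊆ =
        loop-supported r (within-replace S⊆ (pick-∈ S S≢[]) within-[]) out⊆
      loop-supported (iterate {S} S≢[] _ _ (atLeaf _ eq) r) S⊆ out⊆ =
        loop-supported r (within-replace S⊆ z∈S within-[])
          (supported-≔ (within-∈ S⊆ z∈S _ (children⇒Leaves (pick S) eq)) out⊆)
        where z∈S = pick-∈ S S≢[]
      loop-supported {Found} {Excl} {v} {s} (iterate {S} {out = out} S≢[] _ _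
                       (expand {u₁} {u₂} {Found₁} {Found₂} _ eq run₁ run₂) r) S⊆ out⊆ =
        loop-supported r
          (within-++ (pendingIf isZero₁ u₁) (within-⊆ u₁⊆v (within-pendingIf isZero₁ u₁))
            (within-++ (pendingIf isZero₂ u₂) (within-⊆ u₂⊆v (within-pendingIf isZero₂ u₂))
              (λ ℓ ℓ∈ → S⊆ ℓ (LeavesOf-∖⁻ ℓ ℓ∈))))
          (supported-⊕ {F = out ⊕ acceptedIf isZero₁ Found₁}
            (supported-⊕ {F = out} out⊆
              (supported-⊆ u₁⊆v (supported-acceptedIf isZero₁ (supported run₁))))
            (supported-⊆ u₂⊆v (supported-acceptedIf isZero₂ (supported run₂))))
        where
        Excl′ = Excl ++ (S ∖ pick S)
        isZero₁ = ZeroTest (Found ⊕ out ⊕ Found₁) (u₂ ∷ Excl′) u₁ s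
        isZero₂ = ZeroTest (Found ⊕ out ⊕ Found₂) (u₁ ∷ Excl′) u₂ s
        ch = children⇒Children (pick S) eq
        z⊆v : ∀ ℓ → Leaves (pick S) ℓ → Leaves v ℓ
        z⊆v = within-∈ S⊆ (pick-∈ S S≢[])
        u₁⊆v : ∀ ℓ → Leaves u₁ ℓ → Leaves v ℓ
        u₁⊆v ℓ p = z⊆v ℓ (Children-⊆ˡ ch ℓ p)
        u₂⊆v : ∀ ℓ → Leaves u₂ ℓ → Leaves v ℓ
        u₂⊆v ℓ p = z⊆v ℓ (Children-⊆ʳ ch ℓ p)

    size-∅≤ : ∀ {s} → 0# ≤ s → fromℕ (size ∅) ≤ s
    size-∅≤ 0≤s = subst (λ n → fromℕ n ≤ _) (sym size-∅) 0≤s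

    loop-size≤ : ∀ {Found Excl s S t out ret} → 0# ≤ s →
                 Loop Found Excl s S t out ret → fromℕ (size ret) ≤ s
    loop-size≤ 0≤s (finish _ out≤)       = out≤
    loop-size≤ 0≤s (giveUp _)            = size-∅≤ 0≤s
    loop-size≤ 0≤s (iterate _ _ _ _ r)   = loop-size≤ 0≤s r

    -- Failure returns `∅`, of size zero, hence the hypothesis `0# ≤ s`. For an accepted child this
    -- bounds the number of heavy leaves by `s-desc`.
    size≤ : ∀ {Found Excl v s ret} → 0# ≤ s → ExactSparseRecovery Found Excl v s ret →
            fromℕ (size ret) ≤ s
    size≤ 0≤s (slow _ _ ret≤)       = ret≤
    size≤ 0≤s (slowTooLarge _ _ _)  = size-∅≤ 0≤s
    size≤ 0≤s (fast _ r)            = loop-size≤ 0≤s r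

    -- The fast procedure

    -- Each pending vertex carries a flat charge `a` for the iteration that removes it, and its
    -- `weight` for rejected descendants. With `a = α * s`, counting steps in units of `a` avoids
    -- dividing by `α`.
    cost : Carrier → VertexSet d → Carrier
    cost a S = fromℕ (∑ (const 1) S) * a + fromℕ (∑ weight S)

    module _ {a : Carrier} (0≤a : 0# ≤ a) where

      cost-++ : ∀ A B → cost a (A ++ B) ≈ cost a A + cost a B
      cost-++ A B = begin-equality
        fromℕ (∑ (const 1) (A ++ B)) * a + fromℕ (∑ weight (A ++ B))
          ≈⟨ +-cong (*-congʳ (Eq.trans (Eq.reflexive (cong fromℕ (∑-++ (const 1) A B))) (fromℕ-+ (∑ (const 1) A) _)))
                    (Eq.trans (Eq.reflexive (cong fromℕ (∑-++ weight A B))) (fromℕ-+ (∑ weight A) _)) ⟩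
        (fromℕ (∑ (const 1) A) + fromℕ (∑ (const 1) B)) * a + (fromℕ (∑ weight A) + fromℕ (∑ weight B))
          ≈⟨ solve 5 (λ m n a x y → (m :+ n) :* a :+ (x :+ y) := (m :* a :+ x) :+ (n :* a :+ y)) Eq.refl
               (fromℕ (∑ (const 1) A)) (fromℕ (∑ (const 1) B)) a (fromℕ (∑ weight A)) (fromℕ (∑ weight B)) ⟩
        cost a A + cost a B ∎
        where
        open ≤-Reasoning
        open Solver

      0≤cost : ∀ S → 0# ≤ cost a S
      0≤cost S = +-nonNeg (*-nonNeg (fromℕ-nonNeg (∑ (const 1) S)) 0≤a) (fromℕ-nonNeg (∑ weight S))

      cost-∖ : ∀ {S z} → z ∈ S → a + fromℕ (weight z) + cost a (S ∖ z) ≤ cost a S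
      cost-∖ {S} {z} z∈S = begin
        a + fromℕ (weight z) + cost a (S ∖ z)
          ≈⟨ solve 4 (λ a x m y → (a :+ x) :+ (m :* a :+ y) := (con 1 :+ m) :* a :+ (x :+ y)) Eq.refl
               a (fromℕ (weight z)) (fromℕ (∑ (const 1) (S ∖ z))) (fromℕ (∑ weight (S ∖ z))) ⟩
        fromℕ (suc (∑ (const 1) (S ∖ z))) * a + (fromℕ (weight z) + fromℕ (∑ weight (S ∖ z)))
          ≈⟨ +-congˡ (fromℕ-+ (weight z) _) ⟨
        fromℕ (suc (∑ (const 1) (S ∖ z))) * a + fromℕ (weight z ℕ.+ ∑ weight (S ∖ z))
          ≲⟨ +-mono-≤ (*-monoʳ-≤ 0≤a (fromℕ-mono (∑-∖ (const 1) z∈S))) (fromℕ-mono (∑-∖ weight z∈S)) ⟩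
        cost a S ∎
        where
        open ≤-Reasoning
        open Solver

      -- The flat charge of `z` pays for the step, so only `A` has to be paid for from `weight z`.
      cost-step : ∀ {S z t K} → z ∈ S → ∀ A → cost a A ≤ fromℕ (weight z) →
                  fromℕ t * a + cost a S ≤ K → fromℕ (suc t) * a + cost a (A ++ (S ∖ z)) ≤ K
      cost-step {S} {z} {t} {K} z∈S A A≤z bound = begin
        fromℕ (suc t) * a + cost a (A ++ (S ∖ z))
          ≈⟨ +-congˡ (cost-++ A (S ∖ z)) ⟩
        fromℕ (suc t) * a + (cost a A + cost a (S ∖ z))
          ≲⟨ +-monoʳ-≤ _ (+-mono-≤ A≤z ≤-refl) ⟩
        fromℕ (suc t) * a + (fromℕ (weight z) + cost a (S ∖ z))
          ≈⟨ solve 4 (λ t a x y → (con 1 :+ t) :* a :+ (x :+ y) := t :* a :+ (a :+ x :+ y)) Eq.refl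
               (fromℕ t) a (fromℕ (weight z)) (cost a (S ∖ z)) ⟩
        fromℕ t * a + (a + fromℕ (weight z) + cost a (S ∖ z))
          ≲⟨ +-monoʳ-≤ _ (cost-∖ z∈S) ⟩
        fromℕ t * a + cost a S  ≲⟨ bound ⟩
        K                       ∎
        where
        open ≤-Reasoning
        open Solver

      cost-[] : cost a [] ≈ 0#
      cost-[] = Eq.trans (+-congʳ (zeroˡ a)) (+-identityʳ 0#)

      cost-[]≤ : ∀ n → cost a [] ≤ fromℕ n
      cost-[]≤ n = ≤-trans (≤-reflexive cost-[]) (fromℕ-nonNeg n)

      cost-[_] : ∀ u → cost a [ u ] ≈ a + fromℕ (weight u)
      cost-[ u ] = +-cong (Eq.trans (*-congʳ fromℕ-1) (*-identityˡ a))
                          (Eq.reflexive (cong fromℕ (ℕ.+-identityʳ (weight u))))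

      -- The flat charge `a` is paid by one more multiple of the heavy leaves of `u`; for a rejected
      -- child the new factor is the height of its parent.
      cost-heavy : ∀ u → a ≤ fromℕ (∣HeavyLeaves∣ u) →
                   cost a [ u ] ≤ fromℕ (suc (height u) ℕ.* ∣HeavyLeaves∣ u)
      cost-heavy u a≤h = begin
        cost a [ u ]                                   ≈⟨ cost-[ u ] ⟩
        a + fromℕ (weight u)                           ≲⟨ +-mono-≤ a≤h ≤-refl ⟩
        fromℕ (∣HeavyLeaves∣ u) + fromℕ (weight u)     ≈⟨ fromℕ-+ (∣HeavyLeaves∣ u) (weight u) ⟨
        fromℕ (suc (height u) ℕ.* ∣HeavyLeaves∣ u)     ∎
        where open ≤-Reasoning

      -- Each share is `height z` times the heavy leaves of a child, and the heavy leaves of the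
      -- siblings are disjoint parts of those of `z`.
      cost-children : ∀ {z u₁ u₂} → Children z u₁ u₂ → ∀ A₁ A₂ →
        cost a A₁ ≤ fromℕ (suc (height u₁) ℕ.* ∣HeavyLeaves∣ u₁) →
        cost a A₂ ≤ fromℕ (suc (height u₂) ℕ.* ∣HeavyLeaves∣ u₂) →
        cost a (A₁ ++ A₂) ≤ fromℕ (weight z)
      cost-children {z} {u₁} {u₂} ch A₁ A₂ A₁≤ A₂≤ = begin
        cost a (A₁ ++ A₂)                                              ≈⟨ cost-++ A₁ A₂ ⟩
        cost a A₁ + cost a A₂                                          ≲⟨ +-mono-≤ A₁≤′ A₂≤′ ⟩
        fromℕ (n ℕ.* h₁) + fromℕ (n ℕ.* h₂)                            ≈⟨ fromℕ-+ (n ℕ.* h₁) (n ℕ.* h₂) ⟨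
        fromℕ (n ℕ.* h₁ ℕ.+ n ℕ.* h₂)                                  ≲⟨ fromℕ-mono n*h₁+n*h₂≤ ⟩
        fromℕ (weight z)                                               ∎
        where
        open ≤-Reasoning
        n  = height z
        h₁ = ∣HeavyLeaves∣ u₁
        h₂ = ∣HeavyLeaves∣ u₂
        A₁≤′ : cost a A₁ ≤ fromℕ (n ℕ.* h₁)
        A₁≤′ = subst (λ n → cost a A₁ ≤ fromℕ (n ℕ.* h₁)) (sym (Children-heightˡ ch)) A₁≤
        A₂≤′ : cost a A₂ ≤ fromℕ (n ℕ.* h₂)
        A₂≤′ = subst (λ n → cost a A₂ ≤ fromℕ (n ℕ.* h₂)) (sym (Children-heightʳ ch)) A₂≤
        n*h₁+n*h₂≤ : n ℕ.* h₁ ℕ.+ n ℕ.* h₂ ≤ⁿ weight z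
        n*h₁+n*h₂≤ = ℕ.≤-trans (ℕ.≤-reflexive (sym (ℕ.*-distribˡ-+ n h₁ h₂)))
                               (ℕ.*-monoʳ-≤ n (∣HeavyLeaves∣-children ch))

    -- Budgets of recursive calls and initial costs.

    h≤k-size : ∀ {Found Excl u} → Admissible Found Excl u →
               fromℕ (∣HeavyLeaves∣ u) ≤ fromℕ k - fromℕ (size Found)
    h≤k-size {Found} {u = u} adm = x+y≤z⇒y≤z-x (≤-trans
      (≤-reflexive (Eq.sym (fromℕ-+ (size Found) (∣HeavyLeaves∣ u))))
      (fromℕ-mono (ℕ.≤-trans (size-+-∣HeavyLeaves∣ (nonZero adm) (fresh adm)) heavy≤k)))

    0≤αs : ∀ {s} → 1# / α < s → 0# ≤ α * s
    0≤αs 1/α<s = ≤-trans 0≤1 (1/α<s⇒1≤αs 1≤d 1≤k 1/α<s)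

    slow-initial : ∀ v → 1 ℕ.+ ∑ slowCost [ v ] ≤ⁿ 2 ℕ.+ 2 ℕ.* (d ℕ.* ∣HeavyLeaves∣ v)
    slow-initial v = s≤s (ℕ.≤-trans (ℕ.≤-reflexive (ℕ.+-identityʳ (slowCost v)))
      (s≤s (ℕ.*-monoʳ-≤ 2 (weight≤ v))))

    -- The two summands `α * s` on the right stand for the initial `Steps = 1` and the flat charge
    -- of `v`; the weight of `v` is at most `d * s`.
    fast-initial : ∀ v {s} → 1# / α < s → fromℕ (∣HeavyLeaves∣ v) ≤ s →
                   fromℕ 1 * (α * s) + cost (α * s) [ v ] ≤ (α * s + α * s) + fromℕ d * s
    fast-initial v {s} 1/α<s h≤s = begin
      fromℕ 1 * a + cost a [ v ]          ≈⟨ +-cong (Eq.trans (*-congʳ fromℕ-1) (*-identityˡ a))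
                                                  (cost-[_] (0≤αs 1/α<s) v) ⟩
      a + (a + fromℕ (weight v))          ≈⟨ +-assoc a a _ ⟨
      (a + a) + fromℕ (weight v)          ≲⟨ +-monoʳ-≤ _ (fromℕ-mono (weight≤ v)) ⟩
      (a + a) + fromℕ (d ℕ.* ∣HeavyLeaves∣ v)
                                          ≈⟨ +-congˡ (fromℕ-* d _) ⟩
      (a + a) + fromℕ d * fromℕ (∣HeavyLeaves∣ v)
                                          ≲⟨ +-monoʳ-≤ _ (*-monoˡ-≤ (fromℕ-nonNeg d) h≤s) ⟩
      (a + a) + fromℕ d * s               ∎
      where
      open ≤-Reasoning
      a = α * s

    -- A result accepted by ZeroTest has an entry for every heavy leaf of u, so
    -- there are at most s-desc of them and the recursive call was within
    -- budget.  A rejected u has more than α s heavy leaves, since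
    -- k − |Found| ≥ |HeavyLeaves(u)| always.
    child-correct : ∀ {Found Excl u s Found′} → Admissible Found Excl u →
      fromℕ (∣HeavyLeaves∣ u) ≤ s →
      0# ≤ α * s →
      (let s-desc = (α * s) ⊓ (fromℕ k - fromℕ (size Found))
           isZero = ZeroTest (Found ⊕ Found′) Excl u s) →
      ExactSparseRecovery Found Excl u s-desc Found′ →
      (fromℕ (∣HeavyLeaves∣ u) ≤ s-desc → Progress u [] Found′) →
      Progress u (pendingIf isZero u) (acceptedIf isZero Found′) ×
      cost (α * s) (pendingIf isZero u) ≤ fromℕ (suc (height u) ℕ.* ∣HeavyLeaves∣ u)
    child-correct {Found} {Excl} {u} {s} {Found′} adm h≤s 0≤a run ih
      with ZeroTest (Found ⊕ Found′) Excl u s in zt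
    ... | true  = ih (≤-trans (fromℕ-mono (∣HeavyLeaves∣≤size accepted)) (size≤ 0≤s-desc run)) ,
                  cost-[]≤ 0≤a (suc (height u) ℕ.* ∣HeavyLeaves∣ u)
      where
      accepted : ∀ ℓ → Leaves u ℓ → value ℓ ≈ℂ 0ℂ ⊎ Correct Found′ ℓ
      accepted ℓ p = Sum.map₂ (Correct-⊕⁻ ℓ (Found′ ℓ) (fresh adm ℓ p))
        (Equivalence.to (zeroTest-spec _ _ _ _ (isolated-⊕ (isolated adm) (supported run)) h≤s) zt ℓ p)
      0≤s-desc : 0# ≤ (α * s) ⊓ (fromℕ k - fromℕ (size Found))
      0≤s-desc = ⊓-glb 0≤a (≤-trans (fromℕ-nonNeg (∣HeavyLeaves∣ u)) (h≤k-size adm))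
    ... | false = pending u , cost-heavy 0≤a u (≰⇒≥ λ h≤a → rejected (ih (⊓-glb h≤a (h≤k-size adm))))
      where
      rejected : ¬ Progress u [] Found′
      rejected P with () ← trans (sym zt) (Equivalence.from
        (zeroTest-spec _ _ _ _ (isolated-⊕ (isolated adm) (λ ℓ ¬p → support P ℓ (inj₁ ¬p))) h≤s)
        (λ ℓ p → Sum.[ (λ ()) , Sum.map₂ (Correct-⊕ʳ ℓ) ] (covered P ℓ p)))

    -- Correctness of every execution, by mutual induction.

    mutual

      -- The branch `slowTooLarge` is excluded because a correct result has at most as many non-zero
      -- entries as `v` has heavy leaves.
      correctness : ∀ {Found Excl v s ret} → ExactSparseRecovery Found Excl v s ret →
        Admissible Found Excl v → fromℕ (∣HeavyLeaves∣ v) ≤ s → Progress v [] ret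
      correctness {v = v} (slow _ r _) adm h≤s =
        slow-correct r adm h≤s (pending v) (slow-initial v)
      correctness {v = v} (slowTooLarge _ r ret≰) adm h≤s = contradiction
        (≤-trans (fromℕ-mono (size≤∣HeavyLeaves∣ (slow-correct r adm h≤s (pending v) (slow-initial v)))) h≤s)
        ret≰
      correctness {v = v} (fast 1/α<s r) adm h≤s =
        loop-correct r 1/α<s adm h≤s (pending v) (fast-initial v 1/α<s h≤s)

      -- Both reasons for giving up contradict the invariant: the step limit by the bound on the
      -- cost, the size limit by `P`.
      loop-correct : ∀ {Found Excl v s S t out ret} → Loop Found Excl s S t out ret →
        1# / α < s → Admissible Found Excl v → fromℕ (∣HeavyLeaves∣ v) ≤ s → Progress v S out →
        fromℕ t * (α * s) + cost (α * s) S ≤ (α * s + α * s) + fromℕ d * s →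
        Progress v [] ret
      loop-correct (finish _ _) 1/α<s adm h≤s P bound = P
      loop-correct {s = s} (giveUp {S} {t} (inj₁ t≰)) 1/α<s adm h≤s P bound = contradiction
        (steps≤limit 1≤d 1≤k 1/α<s (begin
          fromℕ t * (α * s)                      ≈⟨ +-identityʳ _ ⟨
          fromℕ t * (α * s) + 0#                 ≲⟨ +-monoʳ-≤ _ (0≤cost (0≤αs 1/α<s) S) ⟩
          fromℕ t * (α * s) + cost (α * s) S     ≲⟨ bound ⟩
          (α * s + α * s) + fromℕ d * s          ∎)) t≰
        where open ≤-Reasoning
      loop-correct (giveUp (inj₂ out≰)) 1/α<s adm h≤s P bound =
        contradiction (≤-trans (fromℕ-mono (size≤∣HeavyLeaves∣ P)) h≤s) out≰
      loop-correct {s = s} (iterate {S} {t} {out} {S′} {out′} S≢[] _ _ it r) 1/α<s adm h≤s P bound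
        with A , G , refl , out⊕G≗out′ , Q , A≤z ← iteration-correct it 1/α<s
               (admissible-pick adm P (pick-∈ S S≢[]))
               (≤-trans (fromℕ-mono (∣HeavyLeaves∣-⊆ (within-∈ (within P) (pick-∈ S S≢[])))) h≤s)
        = loop-correct r 1/α<s adm h≤s
            (Progress-resp out⊕G≗out′ (replace P (pick-∈ S S≢[]) Q))
            (cost-step (0≤αs 1/α<s) {t = t} (pick-∈ S S≢[]) A A≤z bound)

      -- All outcomes are brought to one shape: `z` gives way to `A`, and `out` grows by `G`, which
      -- is right below `z` apart from `A`. The loop then needs only `replace` and `cost-step`.
      iteration-correct : ∀ {Found Excl s z S out S′ out′} →
        Iteration Found Excl s z S out S′ out′ → 1# / α < s →
        Admissible Found Excl z → fromℕ (∣HeavyLeaves∣ z) ≤ s →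
        ∃₂ λ A G → S′ ≡ A ++ S × (∀ ℓ → (out ⊕ G) ℓ ≡ out′ ℓ) ×
                   Progress z A G × cost (α * s) A ≤ fromℕ (weight z)
      iteration-correct {z = z} (discard zt) 1/α<s adm h≤s =
        [] , ∅ , refl , (λ _ → refl) , zeroTest-true adm h≤s zt , cost-[]≤ (0≤αs 1/α<s) (weight z)
      iteration-correct {z = z} {out = out} (atLeaf {ℓ} _ eq) 1/α<s adm h≤s =
        [] , _ , refl , ≔-⊕ out ℓ _ , estimate-correct adm eq , cost-[]≤ (0≤αs 1/α<s) (weight z)
      iteration-correct {Found} {Excl} {s} {z} {S} {out}
        (expand {u₁} {u₂} {Found₁} {Found₂} _ eq run₁ run₂) 1/α<s adm h≤s =
        A₁ ++ A₂ , G₁ ⊕ G₂ , sym (++-assoc A₁ A₂ S) , assoc , join ch (proj₁ result₁) (proj₁ result₂) ,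
        cost-children (0≤αs 1/α<s) ch A₁ A₂ (proj₂ result₁) (proj₂ result₂)
        where
        ch = children⇒Children z eq
        isZero₁ = ZeroTest (Found ⊕ Found₁) (u₂ ∷ Excl) u₁ s
        isZero₂ = ZeroTest (Found ⊕ Found₂) (u₁ ∷ Excl) u₂ s
        A₁ = pendingIf isZero₁ u₁
        A₂ = pendingIf isZero₂ u₂
        G₁ = acceptedIf isZero₁ Found₁
        G₂ = acceptedIf isZero₂ Found₂
        adm₁ : Admissible Found (u₂ ∷ Excl) u₁
        adm₁ = admissible-child (Children-⊆ˡ ch) (Children-disjoint ch) (Children-cover ch) adm
        adm₂ : Admissible Found (u₁ ∷ Excl) u₂
        adm₂ = admissible-child (Children-⊆ʳ ch) (λ ℓ p q → Children-disjoint ch ℓ q p)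
                 (λ ℓ p → Sum.swap (Children-cover ch ℓ p)) adm
        -- `correctness run₁ adm₁` still awaits its budget hypothesis; `child-correct` decides
        -- whether that holds.
        result₁ = child-correct adm₁ (≤-trans (fromℕ-mono (∣HeavyLeaves∣-⊆ (Children-⊆ˡ ch))) h≤s)
                    (0≤αs 1/α<s) run₁ (correctness run₁ adm₁)
        result₂ = child-correct adm₂ (≤-trans (fromℕ-mono (∣HeavyLeaves∣-⊆ (Children-⊆ʳ ch))) h≤s)
                    (0≤αs 1/α<s) run₂ (correctness run₂ adm₂)
        assoc : ∀ ℓ → (out ⊕ (G₁ ⊕ G₂)) ℓ ≡ (out ⊕ G₁ ⊕ G₂) ℓ
        assoc ℓ = <∣>-assoc (G₂ ℓ) (G₁ ℓ) (out ℓ)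

-- The procedures are relations, so total correctness has two halves: an execution exists, and every
-- execution returns correct estimates.
theorem6 :
    ∀ {c ℓ₁ ℓ₂} (ℛ : Reals c ℓ₁ ℓ₂) (d k : ℕ) →
    1 ≤ⁿ d → 1 ≤ⁿ k →
    let open Reals ℛ
        open SparseRecovery ℛ d k in
    (value : Leaf d → ℂ) →
    let open Values value in
    ∣HeavyLeaves∣ root ≤ⁿ k →
    (selector : Selector d) (primitives : Primitives) →
    let open Procedures selector primitives in
    (∀ (Found : Array) (Excl : VertexSet d) (v : Vertex d) (s : Carrier) →
       s ≤ fromℕ k →
       NonZeroOnlyAtHeavy Found →
       Isolated Found Excl v →
       (∀ ℓ → Leaves v ℓ → Found ℓ ≡ nothing) →
       fromℕ (∣HeavyLeaves∣ v) ≤ s →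
       ∃ (λ ret → ExactSparseRecovery Found Excl v s ret) ×
       (∀ ret → ExactSparseRecovery Found Excl v s ret →
          ∀ ℓ → HeavyLeaves v ℓ → Correct ret ℓ))
    ×
    (∀ (s : Carrier) →
       s ≤ fromℕ k →
       fromℕ (∣HeavyLeaves∣ root) ≤ s →
       ∃ (λ ret → ExactSparseRecovery ∅ [] root s ret) ×
       (∀ ret → ExactSparseRecovery ∅ [] root s ret → RecoversTree ret))
theorem6 ℛ d k 1≤d 1≤k value heavy≤k selector primitives =
  (λ Found Excl v s _ nz iso fr h≤s →
    runs Found Excl v s ,
    λ ret r ℓ (p , ℓ≉0) → heavy-correct
      (correctness r (record { nonZero = nz ; isolated = iso ; fresh = fr }) h≤s) p ℓ≉0) ,
  (λ s _ h≤s → runs ∅ [] root s , λ ret r → recovers (correctness r initial h≤s))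
  where
  open Reals ℛ
  open SparseRecovery ℛ d k
  open Values value
  open Procedures selector primitives
  open Recovery ℛ d k value selector primitives
  open Correctness 1≤d 1≤k heavy≤k
  open Progress

  runs : ∀ Found Excl v s → ∃ (ExactSparseRecovery Found Excl v s)
  runs Found Excl v s = terminates (suc (height v)) v ℕ.≤-refl Found Excl s

  heavy-correct : ∀ {v ret ℓ} → Progress v [] ret → Leaves v ℓ → Heavy ℓ → Correct ret ℓ
  heavy-correct {ℓ = ℓ} P p ℓ≉0 with covered P ℓ p
  ... | inj₂ (inj₁ ℓ≈0) = contradiction ℓ≈0 ℓ≉0
  ... | inj₂ (inj₂ o)   = o

  initial : Admissible ∅ [] root
  initial = record
    { nonZero  = λ _ ()
    ; isolated = record { disjoint = λ _ _ () ; outside = λ _ ¬p → contradiction root≼ ¬p }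
    ; fresh    = λ _ _ → refl
    }

  -- Recorded entries are correct even at zero leaves, and a missing entry is read as `0ℂ`, which is
  -- right because an unrecorded leaf is zero.
  recovers : ∀ {ret} → Progress root [] ret → RecoversTree ret
  recovers {ret} P ℓ with ret ℓ | correct P ℓ | covered P ℓ root≼
  ... | just x  | ok | _               = ok refl
  ... | nothing | _  | inj₂ (inj₁ ℓ≈0) = ≈ℂ-sym ℓ≈0
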